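{- Let $\hat{\boldsymbol{\phi}}=(\phi_i^{[L]})_{i\ge0,\,L\ge1}$ be elements of a partially ordered commutative ring $R$, with $\phi_i^{[L]}:=0$ for $i<0$, such that the lower-triangular matrix $\Phi=(\phi^{[j+1]}_{i-j})_{i,j\ge0}$ is TP$_r$. Then: (a) The lower-triangular matrix $(\hat L_{n,k}(\hat{\boldsymbol{\phi}}))_{n,k\ge0}$ is TP$_r$. (c) The sequence $(\hat L_{n+1,1}(\hat{\boldsymbol{\phi}}))_{n\ge0}$ is Hankel-TP$_r$.
   Context: A partially ordered commutative ring is a commutative ring $R$ ($1\ne0$) with a subset $\mathcal P$ of nonnegative elements such that $0,1\in\mathcal P$, $\mathcal P$ is closed under addition and multiplication, and $\mathcal P\cap(-\mathcal P)=\{0\}$. A matrix is TP$_r$ if all its minors of size $\le r$ are nonnegative ($r$ a positive integer or $\infty$); a sequence $(a_n)$ is Hankel-TP$_r$ if $(a_{i+j})_{i,j\ge0}$ is TP$_r$. Level of a vertex: for a forest $F$ of increasing trees on a totally ordered vertex set with $k$ trees and a vertex $j$, let $r_j$ be the number of trees containing at least one vertex $\le j$; the level of $j$ is the number of children of vertices $<j$ whose labels are $>j$, plus $k+1-r_j$. An ordered tree is a rooted tree with linearly ordered children at each vertex; an increasing ordered tree on a set of integers is one bijectively labeled by that set so that children have larger labels than parents. $\hat L_{n,k}(\hat{\boldsymbol{\phi}})$ is the polynomial (evaluated in $R$) equal to the sum over unordered forests of $k$ increasing ordered trees whose vertex sets partition $[n]$ of $\prod_v\phi^{[L(v)]}_{i(v)}$,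 where $i(v)$ is the number of children and $L(v)$ the level of $v$ ($\hat L_{0,0}=1$). -}

module Defs where

open import Level using (Level; _⊔_) renaming (suc to lsuc)
open import Algebra.Bundles using (CommutativeRing)
open import Data.Nat.Base using (ℕ; zero; suc; _∸_; _≤_; _<_; _≡ᵇ_; _<ᵇ_) renaming (_+_ to _+ℕ_)
open import Data.Fin.Base using (Fin; toℕ; punchIn) renaming (zero to fzero; suc to fsuc; _<_ to _<ᶠ_)
open import Data.Bool.Base using (Bool; true; false; _∧_; _∨_; not; if_then_else_)
open import Data.Maybe.Base using (Maybe; just; nothing)
open import Data.Product.Base using (Σ; _×_; _,_)
open import Data.List.Base using (List; []; _∷_; allFin; filterᵇ; length; map; foldr; concatMap)
open import Data.Unit.Base using (⊤)
open import Relation.Nullary using (¬_)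

record POCRing (c ℓ : Level) : Set (lsuc (c ⊔ ℓ)) where
  field
    commRing : CommutativeRing c ℓ
  open CommutativeRing commRing public
  field
    -- the subset 𝒫 of nonnegative elements (a predicate respecting ≈)
    P        : Carrier → Set ℓ
    P-resp   : ∀ {x y} → x ≈ y → P x → P y
    P-0      : P 0#
    P-1      : P 1#
    P-+      : ∀ {x y} → P x → P y → P (x + y)
    P-*      : ∀ {x y} → P x → P y → P (x * y)
    P-antisym : ∀ {x} → P x → P (- x) → x ≈ 0#
    nontrivial : ¬ (1# ≈ 0#)

data Rank : Set where
  fin : ℕ → Rank
  ∞   : Rank

_≤r_ : ℕ → Rank → Set
k ≤r fin n = k ≤ n
k ≤r ∞     = ⊤

StrictInc : ∀ {k} → (Fin k → ℕ) → Set
StrictInc {k} f = ∀ (a b : Fin k) → a <ᶠ b → f a < f b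

module _ {c ℓ} (R : POCRing c ℓ) where
  open POCRing R

  alt : ℕ → Carrier → Carrier
  alt zero    x = x
  alt (suc m) x = - alt m x

  sumR : List Carrier → Carrier
  sumR = foldr _+_ 0#

  prodR : List Carrier → Carrier
  prodR = foldr _*_ 1#

  det : ∀ {k} → (Fin k → Fin k → Carrier) → Carrier
  det {zero}  M = 1#
  det {suc k} M = sumR (map (λ j → alt (toℕ j) (M fzero j * det (λ a b → M (fsuc a) (punchIn j b)))) (allFin (suc k)))

  TP : (ℕ → ℕ → Carrier) → Rank → Set ℓ
  TP A r = ∀ (k : ℕ) → 1 ≤ k → k ≤r r → (I J : Fin k → ℕ) → StrictInc I → StrictInc J →
           P (det (λ a b → A (I a) (J b)))

  HankelTP : (ℕ → Carrier) → Rank → Set ℓ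
  HankelTP a r = TP (λ i j → a (i +ℕ j)) r

  -- φ L i stands for φ^{[L]}_i (values at L = 0 are never used)
  -- Φ = (φ^{[j+1]}_{i-j})_{i,j ≥ 0}, with φ_i := 0 for i < 0
  Φmat : (ℕ → ℕ → Carrier) → ℕ → ℕ → Carrier
  Φmat φ i j = if j <ᵇ suc i then φ (suc j) (i ∸ j) else 0#

-- Increasing ordered forests on [n] (vertices 1..n encoded as Fin n, order preserved)
--
-- A forest is encoded by
--   par : Fin n → Maybe (Fin n)   -- parent of a vertex (nothing for a root)
--   pos : Fin n → Fin n           -- position of a vertex among its siblings
-- subject to `validᵇ`: parents have smaller labels; roots have pos 0
-- (the trees of the forest are unordered); the children of each vertex u
-- have pairwise distinct positions in {0,…,#children(u)-1}, i.e. pos gives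
-- the linear order of the children of u.

Forest : ℕ → Set
Forest n = (Fin n → Maybe (Fin n)) × (Fin n → Fin n)

allFuns : ∀ {a} {A : Set a} (n : ℕ) → List A → List (Fin n → A)
allFuns zero    xs = (λ ()) ∷ []
allFuns (suc n) xs = concatMap (λ x → map (λ f → λ { fzero → x ; (fsuc i) → f i }) (allFuns n xs)) xs

allForestCandidates : (n : ℕ) → List (Forest n)
allForestCandidates n =
  concatMap (λ p → map (λ q → p , q) (allFuns n (allFin n)))
            (allFuns n (nothing ∷ map just (allFin n)))

count : ∀ {n} → (Fin n → Bool) → ℕ
count {n} p = length (filterᵇ p (allFin n))

allᶠ : ∀ {n} → (Fin n → Bool) → Bool
allᶠ {n} p = foldr (λ i b → p i ∧ b) true (allFin n)

anyᶠ : ∀ {n} → (Fin n → Bool) → Bool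
anyᶠ {n} p = foldr (λ i b → p i ∨ b) false (allFin n)

_=ᶠ_ : ∀ {n} → Fin n → Fin n → Bool
a =ᶠ b = toℕ a ≡ᵇ toℕ b

_<ᶠᵇ_ : ∀ {n} → Fin n → Fin n → Bool
a <ᶠᵇ b = toℕ a <ᵇ toℕ b

isRoot : ∀ {n} → (Fin n → Maybe (Fin n)) → Fin n → Bool
isRoot par v with par v
... | nothing = true
... | just _  = false

isParentOf : ∀ {n} → (Fin n → Maybe (Fin n)) → Fin n → Fin n → Bool
isParentOf par u w with par w
... | nothing = false
... | just u' = u' =ᶠ u

nChildren : ∀ {n} → Forest n → Fin n → ℕ
nChildren (par , pos) u = count (isParentOf par u)

nTrees : ∀ {n} → Forest n → ℕ
nTrees (par , pos) = count (isRoot par)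

validᵇ : ∀ {n} → Forest n → Bool
validᵇ {n} F@(par , pos) =
  allᶠ (λ v → vertexOK v (par v)) ∧
  allᶠ (λ v → allᶠ (λ w → not (v =ᶠ w) ∧ sameParent (par v) (par w) →ᵇ not (pos v =ᶠ pos w)))
  where
  _→ᵇ_ : Bool → Bool → Bool
  a →ᵇ b = not a ∨ b
  infixr 0 _→ᵇ_
  vertexOK : Fin n → Maybe (Fin n) → Bool
  vertexOK v nothing  = toℕ (pos v) ≡ᵇ 0
  vertexOK v (just u) = (u <ᶠᵇ v) ∧ (toℕ (pos v) <ᵇ nChildren F u)
  sameParent : Maybe (Fin n) → Maybe (Fin n) → Bool
  sameParent (just u) (just u') = u =ᶠ u'
  sameParent _        _         = false

-- root of the tree containing v (follow parents; n steps suffice)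
rootOf : ∀ {n} → Forest n → Fin n → Fin n
rootOf {n} (par , pos) = go n
  where
  go : ℕ → Fin n → Fin n
  go zero    v = v
  go (suc f) v with par v
  ... | nothing = v
  ... | just u  = go f u

level : ∀ {n} → Forest n → Fin n → ℕ
level F@(par , pos) j =
  count (λ w → (j <ᶠᵇ w) ∧ anyᶠ (λ u → (u <ᶠᵇ j) ∧ isParentOf par u w))
  +ℕ (suc (nTrees F) ∸ rⱼ)
  where
  rⱼ : ℕ
  rⱼ = count (λ ρ → isRoot par ρ ∧ anyᶠ (λ w → not (j <ᶠᵇ w) ∧ (rootOf F w =ᶠ ρ)))

module _ {c ℓ} (R : POCRing c ℓ) where
  open POCRing R

  weight : (ℕ → ℕ → Carrier) → ∀ {n} → Forest n → Carrier
  weight φ {n} F = prodR R (map (λ v → φ (level F v) (nChildren F v)) (allFin n))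

  Lhat : (ℕ → ℕ → Carrier) → ℕ → ℕ → Carrier
  Lhat φ n k = sumR R (map (weight φ)
                  (filterᵇ (λ F → validᵇ F ∧ (nTrees F ≡ᵇ k)) (allForestCandidates n)))

{-# OPTIONS --safe #-}

-- In an increasing forest the level of j is 1 plus the number of vertices w > j that are roots or
-- have a parent < j. Deleting the smallest vertex turns its children into roots and therefore
-- preserves all other levels, which gives L̂(n+1,k+1) = Σᵢ L̂(n,i) Ψ(i,k) with
-- Ψ(i,k) = (i!/k!) φ^{[k+1]}_{i-k}. Every minor of Ψ is a natural multiple of the same minor of Φ
-- (or both vanish), so Ψ is TP_r. Now L̂ = 1 ⊕ L̂Ψ, and (a) follows from the Cauchy–Binet formula by
-- induction on the rows. For (c), the Hankel matrix is L̂V, where the columns of V come from the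
-- powers of the production matrix; V = Ψ [e₀ | V′], with V′ equal to V without its top row, is TP_r
-- by the same induction, this time on the columns.
--
-- Minors are handled in the exterior algebra: a form is a function on lists of column indices, and
-- the minor with rows i₁, …, iₖ is the form A i₁ ⋀ ⋯ ⋀ A iₖ.
module Submission where

open import Defs
open import Data.Bool.Base using (Bool; true; false; _∧_; _∨_; not; if_then_else_; T)
import Data.Bool.Properties as Bool
open import Data.Fin.Base using (Fin; toℕ; punchIn) renaming (zero to fzero; suc to fsuc)
import Data.Fin.Properties as Fin
open import Data.List.Base
  using (List; []; _∷_; _++_; map; foldr; length; tabulate; lookup; allFin; upTo; applyUpTo; filterᵇ; concatMap)
open import Data.List.Membership.Propositional.Properties using (∈-lookup)
open import Data.List.Properties
  using (map-id; length-map; map-tabulate; map-applyUpTo; tabulate-lookup; length-tabulate)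
open import Data.List.Relation.Unary.All as All using (All; []; _∷_)
import Data.List.Relation.Unary.All.Properties as All
open import Data.List.Relation.Unary.AllPairs as AllPairs using (AllPairs; []; _∷_)
import Data.List.Relation.Unary.AllPairs.Properties as AllPairs
open import Data.Maybe.Base using (Maybe; just; nothing; maybe; is-nothing)
open import Data.Nat.Base
  using (ℕ; zero; suc; z≤n; s≤s; _≤_; _<_; _<ᵇ_; _≡ᵇ_; _∸_; _!; NonZero)
  renaming (_+_ to _+ℕ_; _*_ to _*ℕ_)
open import Data.Nat.Combinatorics
  using (_C_; nCk+nC[k+1]≡[n+1]C[k+1]; k>n⇒nCk≡0; nCk≡n!/k![n-k]!; nCk≡nC[n∸k]; nCn≡1; k![n∸k]!∣n!)
open import Data.Nat.DivMod using (m/n*n≡m)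
open import Data.Nat.ListAction using (sum)
import Data.Nat.Properties as ℕ
open import Data.Product.Base using (∃; _×_; _,_)
open import Data.Sum.Base using (_⊎_; inj₁; inj₂)
open import Data.Unit.Base using (⊤)
open import Function.Base using (_∘_; id; case_of_)
open import Relation.Binary.PropositionalEquality as ≡ using (_≡_; _≢_)
open import Relation.Nullary using (yes; no; contradiction)

-- Minors

-- The factor i!/k! is a count. If i trees remain after the smallest vertex is deleted, there are
-- C(i,k) ways to say which k of them were trees of their own, and (i-k)! orders for the others as
-- children of the deleted vertex. That vertex has level k+1, because no vertex precedes it and only
-- the k other roots are pending. Over the rationals, Ψ would be the conjugate of Φ by the diagonal
-- matrix of factorials. In R the product of the j! cannot be cancelled: integers need not be
-- invertible, and a multiple of an element may be nonnegative although the element is not. What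
-- helps is that Φ is lower triangular. The terms of a minor that survive this use only entries with
-- i ≥ j, so all of them are multiplied by one and the same natural number, the product of the i!
-- over the product of the j!. The matrices are infinite but sums must be finite, so each product is
-- cut off at a bound above all rows of the minor at hand. With a lower-triangular left factor this
-- loses nothing.

Sorted : List ℕ → Set
Sorted = AllPairs _<_

module Sums {c ℓ} (R : POCRing c ℓ) where
  open POCRing R
  open import Algebra.Properties.Ring ring
  open import Algebra.Properties.CommutativeSemigroup +-commutativeSemigroup using (interchange) public
  open import Relation.Binary.Reasoning.Setoid setoid

  ∑ : ∀ {a} {A : Set a} → List A → (A → Carrier) → Carrier
  ∑ xs f = sumR R (map f xs)

  module _ {a} {A : Set a} where

    ∑-cong-All : ∀ {xs : List A} {f g} → All (λ x → f x ≈ g x) xs → ∑ xs f ≈ ∑ xs g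
    ∑-cong-All []       = refl
    ∑-cong-All (p ∷ ps) = +-cong p (∑-cong-All ps)

    ∑-cong : ∀ (xs : List A) {f g} → (∀ x → f x ≈ g x) → ∑ xs f ≈ ∑ xs g
    ∑-cong []       p = refl
    ∑-cong (x ∷ xs) p = +-cong (p x) (∑-cong xs p)

    ∑-0 : ∀ (xs : List A) {f} → (∀ x → f x ≈ 0#) → ∑ xs f ≈ 0#
    ∑-0 []       p = refl
    ∑-0 (x ∷ xs) p = trans (+-cong (p x) (∑-0 xs p)) (+-identityˡ 0#)

    ∑-+ : ∀ (xs : List A) f g → ∑ xs (λ x → f x + g x) ≈ ∑ xs f + ∑ xs g
    ∑-+ []       f g = sym (+-identityˡ 0#)
    ∑-+ (x ∷ xs) f g = trans (+-congˡ (∑-+ xs f g)) (interchange (f x) (g x) _ _)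

    ∑-*ˡ : ∀ (xs : List A) y f → ∑ xs (λ x → y * f x) ≈ y * ∑ xs f
    ∑-*ˡ []       y f = sym (zeroʳ y)
    ∑-*ˡ (x ∷ xs) y f = trans (+-congˡ (∑-*ˡ xs y f)) (sym (distribˡ y (f x) _))

    ∑-*ʳ : ∀ (xs : List A) y f → ∑ xs (λ x → f x * y) ≈ ∑ xs f * y
    ∑-*ʳ xs y f = trans (∑-cong xs (λ x → *-comm (f x) y)) (trans (∑-*ˡ xs y f) (*-comm y _))

    ∑-neg : ∀ (xs : List A) f → ∑ xs (λ x → - f x) ≈ - ∑ xs f
    ∑-neg []       f = sym -0#≈0#
    ∑-neg (x ∷ xs) f = trans (+-congˡ (∑-neg xs f)) (-‿+-comm (f x) _)

    ∑-++ : ∀ (xs ys : List A) f → ∑ (xs ++ ys) f ≈ ∑ xs f + ∑ ys f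
    ∑-++ []       ys f = sym (+-identityˡ _)
    ∑-++ (x ∷ xs) ys f = trans (+-congˡ (∑-++ xs ys f)) (sym (+-assoc (f x) _ _))

    ∑-P : ∀ {xs : List A} {f} → All (λ x → P (f x)) xs → P (∑ xs f)
    ∑-P []       = P-0
    ∑-P (p ∷ ps) = P-+ p (∑-P ps)

  ∑-map : ∀ {a b} {A : Set a} {B : Set b} (h : A → B) (xs : List A) f → ∑ (map h xs) f ≈ ∑ xs (f ∘ h)
  ∑-map h []       f = refl
  ∑-map h (x ∷ xs) f = +-congˡ (∑-map h xs f)

  ∑-swap : ∀ {a b} {A : Set a} {B : Set b} (xs : List A) (ys : List B) (f : A → B → Carrier) →
           ∑ xs (λ x → ∑ ys (f x)) ≈ ∑ ys (λ y → ∑ xs (λ x → f x y))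
  ∑-swap []       ys f = sym (∑-0 ys (λ _ → refl))
  ∑-swap (x ∷ xs) ys f = trans (+-congˡ (∑-swap xs ys f)) (sym (∑-+ ys (f x) _))

  ∑-applyUpTo : ∀ {a} {A : Set a} (h : ℕ → A) n f →
                ∑ (applyUpTo h n) f ≡ ∑ (upTo n) (f ∘ h)
  ∑-applyUpTo h n f = ≡.cong (sumR R)
    (≡.trans (map-applyUpTo h f n) (≡.sym (map-applyUpTo id (f ∘ h) n)))

  ∑-upTo-suc : ∀ n f → ∑ (upTo (suc n)) f ≈ f 0 + ∑ (upTo n) (f ∘ suc)
  ∑-upTo-suc n f = +-congˡ (reflexive (∑-applyUpTo suc n f))

  ∑-upTo-last : ∀ n f → ∑ (upTo (suc n)) f ≈ ∑ (upTo n) f + f n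
  ∑-upTo-last zero    f = trans (+-identityʳ _) (sym (+-identityˡ _))
  ∑-upTo-last (suc n) f = begin
    ∑ (upTo (suc (suc n))) f                        ≈⟨ ∑-upTo-suc (suc n) f ⟩
    f 0 + ∑ (upTo (suc n)) (f ∘ suc)                ≈⟨ +-congˡ (∑-upTo-last n (f ∘ suc)) ⟩
    f 0 + (∑ (upTo n) (f ∘ suc) + f (suc n))        ≈⟨ sym (+-assoc _ _ _) ⟩
    f 0 + ∑ (upTo n) (f ∘ suc) + f (suc n)          ≈⟨ +-congʳ (sym (∑-upTo-suc n f)) ⟩
    ∑ (upTo (suc n)) f + f (suc n)                  ∎

module Minors {c ℓ} (R : POCRing c ℓ) where
  open POCRing R
  open Sums R
  open import Algebra.Properties.Ring ring
  open import Relation.Binary.Reasoning.Setoid setoid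

  -- Neither alternation nor distinctness of the columns is imposed: the identities below concern
  -- signed sums over positions in the list and hold for arbitrary functions.
  Form : Set c
  Form = List ℕ → Carrier

  ∂ : ℕ → Form → Form
  ∂ c G J = G (c ∷ J)

  -- Unfolds to Σⱼ (-1)ʲ f cⱼ * G (c₀ ∷ … ∷ ĉⱼ ∷ …), as in the expansion of a determinant along its first row.
  infixr 6 _⋀_
  _⋀_ : (ℕ → Carrier) → Form → Form
  (f ⋀ G) []      = 0#
  (f ⋀ G) (c ∷ J) = f c * G J - (f ⋀ ∂ c G) J

  unit : Form
  unit []      = 1#
  unit (_ ∷ _) = 0#

  Matrix : Set c
  Matrix = ℕ → ℕ → Carrier

  _ᵀ : Matrix → Matrix
  (A ᵀ) i j = A j i

  minor : Matrix → List ℕ → Form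
  minor A []      = unit
  minor A (i ∷ I) = A i ⋀ minor A I

  ⋀-cong-on : ∀ {q} {Q : ℕ → Set q} {f g F G} → (∀ {c} → Q c → f c ≈ g c) →
              (∀ {J} → All Q J → F J ≈ G J) → ∀ {J} → All Q J → (f ⋀ F) J ≈ (g ⋀ G) J
  ⋀-cong-on p s []       = refl
  ⋀-cong-on p s (x ∷ xs) = +-cong (*-cong (p x) (s xs)) (-‿cong (⋀-cong-on p (λ ys → s (x ∷ ys)) xs))

  ⋀-congˡ : ∀ f {F G} → (∀ J → F J ≈ G J) → ∀ J → (f ⋀ F) J ≈ (f ⋀ G) J
  ⋀-congˡ f s []      = refl
  ⋀-congˡ f s (c ∷ J) = +-cong (*-congˡ (s J)) (-‿cong (⋀-congˡ f (λ J → s (c ∷ J)) J))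

  ⋀-zeroʳ : ∀ f J → (f ⋀ (λ _ → 0#)) J ≈ 0#
  ⋀-zeroʳ f []      = refl
  ⋀-zeroʳ f (c ∷ J) = begin
    f c * 0# - (f ⋀ (λ _ → 0#)) J ≈⟨ +-cong (zeroʳ (f c)) (-‿cong (⋀-zeroʳ f J)) ⟩
    0# - 0#                       ≈⟨ -‿inverseʳ 0# ⟩
    0#                            ∎

  ⋀-zero-on : ∀ {f} G {J} → All (λ c → f c ≈ 0#) J → (f ⋀ G) J ≈ 0#
  ⋀-zero-on G []                 = refl
  ⋀-zero-on {f} G {c ∷ J} (p ∷ ps) = begin
    f c * G J - (f ⋀ ∂ c G) J ≈⟨ +-cong (*-congʳ p) (-‿cong (⋀-zero-on (∂ c G) ps)) ⟩
    0# * G J - 0#             ≈⟨ +-cong (zeroˡ _) -0#≈0# ⟩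
    0# + 0#                   ≈⟨ +-identityˡ 0# ⟩
    0#                        ∎

  ⋀-distribʳ : ∀ f g G J → ((λ c → f c + g c) ⋀ G) J ≈ (f ⋀ G) J + (g ⋀ G) J
  ⋀-distribʳ f g G []      = sym (+-identityˡ 0#)
  ⋀-distribʳ f g G (c ∷ J) = begin
    (f c + g c) * G J - ((λ c → f c + g c) ⋀ ∂ c G) J
      ≈⟨ +-cong (distribʳ (G J) (f c) (g c)) (-‿cong (⋀-distribʳ f g (∂ c G) J)) ⟩
    f c * G J + g c * G J - ((f ⋀ ∂ c G) J + (g ⋀ ∂ c G) J)
      ≈⟨ +-congˡ (sym (-‿+-comm _ _)) ⟩
    f c * G J + g c * G J + (- (f ⋀ ∂ c G) J - (g ⋀ ∂ c G) J)
      ≈⟨ interchange _ _ _ _ ⟩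
    (f ⋀ G) (c ∷ J) + (g ⋀ G) (c ∷ J) ∎

  ⋀-distribˡ : ∀ f F G J → (f ⋀ (λ J → F J + G J)) J ≈ (f ⋀ F) J + (f ⋀ G) J
  ⋀-distribˡ f F G []      = sym (+-identityˡ 0#)
  ⋀-distribˡ f F G (c ∷ J) = begin
    f c * (F J + G J) - (f ⋀ (λ J → F (c ∷ J) + G (c ∷ J))) J
      ≈⟨ +-cong (distribˡ (f c) (F J) (G J)) (-‿cong (⋀-distribˡ f (∂ c F) (∂ c G) J)) ⟩
    f c * F J + f c * G J - ((f ⋀ ∂ c F) J + (f ⋀ ∂ c G) J)
      ≈⟨ +-congˡ (sym (-‿+-comm _ _)) ⟩
    f c * F J + f c * G J + (- (f ⋀ ∂ c F) J - (f ⋀ ∂ c G) J)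
      ≈⟨ interchange _ _ _ _ ⟩
    (f ⋀ F) (c ∷ J) + (f ⋀ G) (c ∷ J) ∎

  *-distrib-- : ∀ x y z → x * (y - z) ≈ x * y - x * z
  *-distrib-- x y z = trans (distribˡ x y (- z)) (+-congˡ (sym (-‿distribʳ-* x z)))

  ⋀-*ˡ : ∀ x f G J → ((λ c → x * f c) ⋀ G) J ≈ x * (f ⋀ G) J
  ⋀-*ˡ x f G []      = sym (zeroʳ x)
  ⋀-*ˡ x f G (c ∷ J) = trans (+-cong (*-assoc x (f c) (G J)) (-‿cong (⋀-*ˡ x f (∂ c G) J)))
                             (sym (*-distrib-- x _ _))

  ⋀-*ʳ : ∀ x f G J → (f ⋀ (λ J → x * G J)) J ≈ x * (f ⋀ G) J
  ⋀-*ʳ x f G []      = sym (zeroʳ x)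
  ⋀-*ʳ x f G (c ∷ J) = trans (+-cong (x∙yz≈y∙xz (f c) x (G J)) (-‿cong (⋀-*ʳ x f (∂ c G) J)))
                             (sym (*-distrib-- x _ _))
    where open import Algebra.Properties.CommutativeSemigroup *-commutativeSemigroup using (x∙yz≈y∙xz)

  ⋀-negʳ : ∀ f G J → (f ⋀ (λ J → - G J)) J ≈ - (f ⋀ G) J
  ⋀-negʳ f G []      = sym -0#≈0#
  ⋀-negʳ f G (c ∷ J) = trans (+-cong (sym (-‿distribʳ-* (f c) (G J))) (-‿cong (⋀-negʳ f (∂ c G) J)))
                             (-‿+-comm _ _)

  ⋀-∑ : ∀ {a} {A : Set a} (xs : List A) f (x : A → Carrier) (G : A → Form) J →
        (f ⋀ (λ J → ∑ xs (λ a → x a * G a J))) J ≈ ∑ xs (λ a → x a * (f ⋀ G a) J)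
  ⋀-∑ []       f x G J = ⋀-zeroʳ f J
  ⋀-∑ (a ∷ xs) f x G J = trans (⋀-distribˡ f (λ J → x a * G a J) _ J)
                               (+-cong (⋀-*ʳ (x a) f (G a) J) (⋀-∑ xs f x G J))

  -- The contraction ∂ c is an antiderivation.
  ⋀-∂⋀ : ∀ f g G c J → (f ⋀ ∂ c (g ⋀ G)) J ≈ g c * (f ⋀ G) J - (f ⋀ g ⋀ ∂ c G) J
  ⋀-∂⋀ f g G c J = trans (⋀-distribˡ f (λ J → g c * G J) (λ J → - (g ⋀ ∂ c G) J) J)
                         (+-cong (⋀-*ʳ (g c) f G J) (⋀-negʳ f (g ⋀ ∂ c G) J))

  -- Both sides are expanded at the first column. The antiderivation rule isolates the terms in
  -- which `f` or `g` takes that column; the double wedge that remains falls to the induction.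
  ⋀-anticomm : ∀ f g G J → (f ⋀ g ⋀ G) J ≈ - (g ⋀ f ⋀ G) J
  ⋀-anticomm f g G []      = sym -0#≈0#
  ⋀-anticomm f g G (c ∷ J) = begin
    f c * (g ⋀ G) J - (f ⋀ ∂ c (g ⋀ G)) J
      ≈⟨ +-congˡ (-‿cong (trans (⋀-∂⋀ f g G c J) (+-congˡ (-‿cong (⋀-anticomm f g (∂ c G) J))))) ⟩
    f c * (g ⋀ G) J - (g c * (f ⋀ G) J - - (g ⋀ f ⋀ ∂ c G) J)
      ≈⟨ +-congˡ (sym (-‿+-comm _ _)) ⟩
    f c * (g ⋀ G) J + (- (g c * (f ⋀ G) J) - - - (g ⋀ f ⋀ ∂ c G) J)
      ≈⟨ x∙yz≈y∙xz _ _ _ ⟩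
    - (g c * (f ⋀ G) J) + (f c * (g ⋀ G) J - - - (g ⋀ f ⋀ ∂ c G) J)
      ≈⟨ +-congˡ (+-congˡ (-‿involutive _)) ⟩
    - (g c * (f ⋀ G) J) + (f c * (g ⋀ G) J - (g ⋀ f ⋀ ∂ c G) J)
      ≈⟨ +-congˡ (sym (⋀-∂⋀ g f G c J)) ⟩
    - (g c * (f ⋀ G) J) + (g ⋀ ∂ c (f ⋀ G)) J
      ≈⟨ +-congˡ (sym (-‿involutive _)) ⟩
    - (g c * (f ⋀ G) J) - - (g ⋀ ∂ c (f ⋀ G)) J
      ≈⟨ -‿+-comm _ _ ⟩
    - (g ⋀ f ⋀ G) (c ∷ J) ∎
    where open import Algebra.Properties.CommutativeSemigroup +-commutativeSemigroup using (x∙yz≈y∙xz)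

  -- This has its own induction: anticommutativity yields only that twice the value is zero, and 2
  -- may be a zero divisor in `R`.
  ⋀-self : ∀ f G J → (f ⋀ f ⋀ G) J ≈ 0#
  ⋀-self f G []      = refl
  ⋀-self f G (c ∷ J) = begin
    f c * (f ⋀ G) J - (f ⋀ ∂ c (f ⋀ G)) J
      ≈⟨ +-congˡ (-‿cong (trans (⋀-∂⋀ f f G c J) (trans (+-congˡ (trans (-‿cong (⋀-self f (∂ c G) J)) -0#≈0#)) (+-identityʳ _)))) ⟩
    f c * (f ⋀ G) J - f c * (f ⋀ G) J ≈⟨ -‿inverseʳ _ ⟩
    0# ∎

  -- Agreement is asked only on the rows and columns that occur, because a truncated product has the
  -- right entries only below its bound.
  minor-cong-on : ∀ {p q} {S : ℕ → Set p} {Q : ℕ → Set q} {A B : Matrix} →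
                  (∀ {i j} → S i → Q j → A i j ≈ B i j) →
                  ∀ {I J} → All S I → All Q J → minor A I J ≈ minor B I J
  minor-cong-on e []       qs = refl
  minor-cong-on e (s ∷ ss) qs = ⋀-cong-on (e s) (minor-cong-on e ss) qs

  -- No sign appears, in contrast to `⋀-anticomm`: `f` consumes an entry of `J` and `g` one of `I`,
  -- so the two extractions are independent. This turns row expansions into column expansions.
  ⋀-swap : ∀ f g (K : List ℕ → List ℕ → Carrier) I J →
           (f ⋀ (λ J → (g ⋀ (λ I → K I J)) I)) J ≈ (g ⋀ (λ I → (f ⋀ K I) J)) I
  ⋀-swap f g K []      J = ⋀-zeroʳ f J
  ⋀-swap f g K (i ∷ I) J = begin
    (f ⋀ (λ J → g i * K I J - (g ⋀ (λ I → K (i ∷ I) J)) I)) J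
      ≈⟨ ⋀-distribˡ f (λ J → g i * K I J) (λ J → - (g ⋀ (λ I → K (i ∷ I) J)) I) J ⟩
    (f ⋀ (λ J → g i * K I J)) J + (f ⋀ (λ J → - (g ⋀ (λ I → K (i ∷ I) J)) I)) J
      ≈⟨ +-cong (⋀-*ʳ (g i) f (K I) J) (⋀-negʳ f (λ J → (g ⋀ (λ I → K (i ∷ I) J)) I) J) ⟩
    g i * (f ⋀ K I) J - (f ⋀ (λ J → (g ⋀ (λ I → K (i ∷ I) J)) I)) J
      ≈⟨ +-congˡ (-‿cong (⋀-swap f g (λ I → K (i ∷ I)) I J)) ⟩
    g i * (f ⋀ K I) J - (g ⋀ (λ I → (f ⋀ K (i ∷ I)) J)) I ∎

  minor-expand-column : ∀ A I c J → minor A I (c ∷ J) ≈ ((A ᵀ) c ⋀ (λ I → minor A I J)) I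
  minor-expand-column A []      c J = refl
  minor-expand-column A (i ∷ I) c J = +-congˡ (-‿cong (trans
    (⋀-congˡ (A i) (minor-expand-column A I c) J)
    (⋀-swap (A i) ((A ᵀ) c) (minor A) I J)))

  minor-transpose : ∀ A I J → minor A I J ≈ minor (A ᵀ) J I
  minor-transpose A []      []      = refl
  minor-transpose A (i ∷ I) []      = refl
  minor-transpose A I       (c ∷ J) = trans (minor-expand-column A I c J)
    (⋀-congˡ ((A ᵀ) c) (λ I → minor-transpose A I J) I)

  ⋀-length : ∀ f {G n} → (∀ J → length J ≢ n → G J ≈ 0#) → ∀ J → length J ≢ suc n → (f ⋀ G) J ≈ 0#
  ⋀-length f h []      ne = refl
  ⋀-length f {G} {n} h (c ∷ J) ne = begin
    f c * G J - (f ⋀ ∂ c G) J ≈⟨ +-cong (trans (*-congˡ (h J (ne ∘ ≡.cong suc))) (zeroʳ _)) (trans (-‿cong (rest n h ne)) -0#≈0#) ⟩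
    0# + 0#                   ≈⟨ +-identityˡ 0# ⟩
    0#                        ∎
    where
    rest : ∀ n → (∀ J → length J ≢ n → G J ≈ 0#) → suc (length J) ≢ suc n → (f ⋀ ∂ c G) J ≈ 0#
    rest zero    h ne = trans (⋀-congˡ f (λ J → h (c ∷ J) λ ()) J) (⋀-zeroʳ f J)
    rest (suc n) h ne = ⋀-length f (λ J ne → h (c ∷ J) (ne ∘ ℕ.suc-injective)) J (ne ∘ ≡.cong suc)

  -- Allows the Cauchy-Binet sum to run over all sublists of the inner indices: those of the wrong
  -- length contribute zero.
  minor-length : ∀ A I J → length J ≢ length I → minor A I J ≈ 0#
  minor-length A []      []      ne = contradiction ≡.refl ne
  minor-length A []      (_ ∷ _) ne = refl
  minor-length A (i ∷ I) J       ne = ⋀-length (A i) (minor-length A I) J ne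

  subs : List ℕ → List (List ℕ)
  subs []       = [] ∷ []
  subs (l ∷ ls) = subs ls ++ map (l ∷_) (subs ls)

  subs-All : ∀ {q} {Q : ℕ → Set q} {ls} → All Q ls → All (All Q) (subs ls)
  subs-All []       = [] ∷ []
  subs-All (q ∷ qs) = All.++⁺ (subs-All qs) (All.map⁺ (All.map (q ∷_) (subs-All qs)))

  subs-sorted : ∀ {ls} → Sorted ls → All Sorted (subs ls)
  subs-sorted []       = [] ∷ []
  subs-sorted (l ∷ s)  = All.++⁺ (subs-sorted s)
    (All.map⁺ (All.zipWith (λ (a , b) → a ∷ b) (subs-All l , subs-sorted s)))

  mul : List ℕ → Matrix → Matrix → Matrix
  mul ls A B i j = ∑ ls (λ l → A i l * B l j)

  -- ⋀ᵢ (uᵢ b + wᵢ) = ⋀ᵢ wᵢ + b ∧ Σᵢ ± uᵢ ⋀_{i' ≠ i} wᵢ', since b ∧ b = 0.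
  minor-rank-one : ∀ (u b : ℕ → Carrier) (W : Matrix) I J →
    minor (λ i j → u i * b j + W i j) I J ≈
    minor W I J + (b ⋀ (λ J → (u ⋀ (λ I → minor W I J)) I)) J
  minor-rank-one u b W []      J = sym (trans (+-congˡ (⋀-zeroʳ b J)) (+-identityʳ _))
  minor-rank-one u b W (i ∷ I) J = begin
    ((λ j → u i * b j + W i j) ⋀ minor (λ i j → u i * b j + W i j) I) J
      ≈⟨ ⋀-congˡ _ (minor-rank-one u b W I) J ⟩
    ((λ j → u i * b j + W i j) ⋀ (λ J → minor W I J + (b ⋀ X) J)) J
      ≈⟨ ⋀-distribʳ (λ j → u i * b j) (W i) _ J ⟩
    ((λ j → u i * b j) ⋀ (λ J → minor W I J + (b ⋀ X) J)) J + (W i ⋀ (λ J → minor W I J + (b ⋀ X) J)) J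
      ≈⟨ +-cong (trans (⋀-*ˡ (u i) b _ J) (*-congˡ (trans (⋀-distribˡ b (minor W I) (b ⋀ X) J)
                  (trans (+-congˡ (⋀-self b X J)) (+-identityʳ _)))))
                (trans (⋀-distribˡ (W i) (minor W I) (b ⋀ X) J) (+-congˡ (⋀-anticomm (W i) b X J))) ⟩
    u i * (b ⋀ minor W I) J + (minor W (i ∷ I) J - (b ⋀ W i ⋀ X) J)
      ≈⟨ x∙yz≈y∙xz _ _ _ ⟩
    minor W (i ∷ I) J + (u i * (b ⋀ minor W I) J - (b ⋀ W i ⋀ X) J)
      ≈⟨ +-congˡ (+-cong (sym (⋀-*ʳ (u i) b (minor W I) J)) (sym (⋀-negʳ b (W i ⋀ X) J))) ⟩
    minor W (i ∷ I) J + ((b ⋀ (λ J → u i * minor W I J)) J + (b ⋀ (λ J → - (W i ⋀ X) J)) J)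
      ≈⟨ +-congˡ (sym (⋀-distribˡ b _ _ J)) ⟩
    minor W (i ∷ I) J + (b ⋀ (λ J → u i * minor W I J - (W i ⋀ X) J)) J
      ≈⟨ +-congˡ (⋀-congˡ b (λ J → +-congˡ (-‿cong (⋀-swap (W i) u (λ I → minor W I) I J))) J) ⟩
    minor W (i ∷ I) J + (b ⋀ (λ J → (u ⋀ (λ I → minor W I J)) (i ∷ I))) J ∎
    where
    open import Algebra.Properties.CommutativeSemigroup +-commutativeSemigroup using (x∙yz≈y∙xz)
    X : Form
    X J = (u ⋀ (λ I → minor W I J)) I

  -- Induction on the inner indices: a further index `l` adds a matrix of rank one, and
  -- `minor-rank-one` separates the inner sets without `l` from those with `l`. The factor from `A`
  -- is transposed so that `l` becomes its first row and enters as a single wedge.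
  cauchy-binet : ∀ A B ls I J →
    minor (mul ls A B) I J ≈ ∑ (subs ls) (λ L → minor (A ᵀ) L I * minor B L J)
  cauchy-binet A B []       []      J = sym (trans (+-identityʳ _) (*-identityˡ _))
  cauchy-binet A B []       (i ∷ I) J = trans (⋀-zero-on (minor (mul [] A B) I) (All.universal (λ _ → refl) J))
                                              (sym (trans (+-identityʳ _) (zeroˡ _)))
  cauchy-binet A B (l ∷ ls) I J = begin
    minor (mul (l ∷ ls) A B) I J
      ≈⟨ minor-rank-one ((A ᵀ) l) (B l) (mul ls A B) I J ⟩
    minor (mul ls A B) I J + (B l ⋀ (λ J → ((A ᵀ) l ⋀ (λ I → minor (mul ls A B) I J)) I)) J
      ≈⟨ +-cong (cauchy-binet A B ls I J) (⋀-congˡ (B l) inner J) ⟩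
    ∑ (subs ls) (λ L → minor (A ᵀ) L I * minor B L J) +
    (B l ⋀ (λ J → ∑ (subs ls) (λ L → minor (A ᵀ) (l ∷ L) I * minor B L J))) J
      ≈⟨ +-congˡ (⋀-∑ (subs ls) (B l) (λ L → minor (A ᵀ) (l ∷ L) I) (minor B) J) ⟩
    ∑ (subs ls) (λ L → minor (A ᵀ) L I * minor B L J) +
    ∑ (subs ls) (λ L → minor (A ᵀ) (l ∷ L) I * minor B (l ∷ L) J)
      ≈⟨ +-congˡ (sym (∑-map (l ∷_) (subs ls) (λ L → minor (A ᵀ) L I * minor B L J))) ⟩
    ∑ (subs ls) (λ L → minor (A ᵀ) L I * minor B L J) +
    ∑ (map (l ∷_) (subs ls)) (λ L → minor (A ᵀ) L I * minor B L J)
      ≈⟨ sym (∑-++ (subs ls) _ _) ⟩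
    ∑ (subs (l ∷ ls)) (λ L → minor (A ᵀ) L I * minor B L J) ∎
    where
    inner : ∀ J → ((A ᵀ) l ⋀ (λ I → minor (mul ls A B) I J)) I ≈
                  ∑ (subs ls) (λ L → minor (A ᵀ) (l ∷ L) I * minor B L J)
    inner J = begin
      ((A ᵀ) l ⋀ (λ I → minor (mul ls A B) I J)) I
        ≈⟨ ⋀-congˡ ((A ᵀ) l) (λ I → trans (cauchy-binet A B ls I J) (∑-cong (subs ls) (λ L → *-comm _ _))) I ⟩
      ((A ᵀ) l ⋀ (λ I → ∑ (subs ls) (λ L → minor B L J * minor (A ᵀ) L I))) I
        ≈⟨ ⋀-∑ (subs ls) ((A ᵀ) l) (λ L → minor B L J) (minor (A ᵀ)) I ⟩
      ∑ (subs ls) (λ L → minor B L J * minor (A ᵀ) (l ∷ L) I)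
        ≈⟨ ∑-cong (subs ls) (λ L → *-comm _ _) ⟩
      ∑ (subs ls) (λ L → minor (A ᵀ) (l ∷ L) I * minor B L J) ∎

  -- The hypothesis on `B` carries the length of `L` because a rank bound speaks of the number of
  -- rows; for `B` these are `L`, and the bound is known for `I`.
  P-minor-mul : ∀ {A B ls} I J → Sorted ls →
    (∀ L → Sorted L → P (minor A I L)) →
    (∀ L → Sorted L → length L ≡ length I → P (minor B L J)) →
    P (minor (mul ls A B) I J)
  P-minor-mul {A} {B} {ls} I J s pA pB =
    P-resp (sym (cauchy-binet A B ls I J)) (∑-P (All.map term (subs-sorted s)))
    where
    term : ∀ {L} → Sorted L → P (minor (A ᵀ) L I * minor B L J)
    term {L} sL with length L ℕ.≟ length I
    ... | yes e = P-* (P-resp (minor-transpose A I L) (pA L sL)) (pB L sL e)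
    ... | no ne = P-resp (sym (trans (*-congʳ (minor-length (A ᵀ) L I (ne ∘ ≡.sym))) (zeroˡ _))) P-0

  alt-cong : ∀ n {x y} → x ≈ y → alt R n x ≈ alt R n y
  alt-cong zero    e = e
  alt-cong (suc n) e = -‿cong (alt-cong n e)

  -- The nested subtractions of `⋀` produce the signs of `alt`: passing over the first column
  -- negates every later term, and `punchIn (fsuc j)` keeps that column in front.
  ⋀-tabulate : ∀ k f G (g : Fin (suc k) → ℕ) →
    (f ⋀ G) (tabulate g) ≈
    ∑ (allFin (suc k)) (λ j → alt R (toℕ j) (f (g j) * G (tabulate (g ∘ punchIn j))))
  ⋀-tabulate zero    f G g = +-congˡ -0#≈0#
  ⋀-tabulate (suc k) f G g = +-congˡ (begin
    - (f ⋀ ∂ (g fzero) G) (tabulate (g ∘ fsuc))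
      ≈⟨ -‿cong (⋀-tabulate k f (∂ (g fzero) G) (g ∘ fsuc)) ⟩
    - ∑ (allFin (suc k)) (λ j → alt R (toℕ j) (f (g (fsuc j)) * ∂ (g fzero) G (tabulate (g ∘ fsuc ∘ punchIn j))))
      ≈⟨ sym (∑-neg (allFin (suc k)) _) ⟩
    ∑ (allFin (suc k)) (λ j → alt R (toℕ (fsuc j)) (f (g (fsuc j)) * G (tabulate (g ∘ punchIn (fsuc j)))))
      ≈⟨ sym (∑-map fsuc (allFin (suc k)) _) ⟩
    ∑ (map fsuc (allFin (suc k))) (λ j → alt R (toℕ j) (f (g j) * G (tabulate (g ∘ punchIn j))))
      ≈⟨ reflexive (≡.cong (λ js → ∑ js (λ j → alt R (toℕ j) (f (g j) * G (tabulate (g ∘ punchIn j)))))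
                    (map-tabulate id fsuc)) ⟩
    ∑ (tabulate fsuc) (λ j → alt R (toℕ j) (f (g j) * G (tabulate (g ∘ punchIn j)))) ∎)

  det-minor : ∀ k A (I J : Fin k → ℕ) → det R (λ a b → A (I a) (J b)) ≈ minor A (tabulate I) (tabulate J)
  det-minor zero    A I J = refl
  det-minor (suc k) A I J = trans
    (∑-cong (allFin (suc k)) (λ j → alt-cong (toℕ j) (*-congˡ (det-minor k A (I ∘ fsuc) (J ∘ punchIn j)))))
    (sym (⋀-tabulate k (A (I fzero)) (minor A (tabulate (I ∘ fsuc))) J))

  NonNegMinors : Matrix → Rank → Set ℓ
  NonNegMinors A r = ∀ I J → Sorted I → Sorted J → length I ≤r r → P (minor A I J)

  lookup-strictInc : ∀ {xs} → Sorted xs → StrictInc (lookup xs)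
  lookup-strictInc (p ∷ s) fzero    (fsuc b) _         = All.lookup p (∈-lookup b)
  lookup-strictInc (p ∷ s) (fsuc a) (fsuc b) (s≤s a<b) = lookup-strictInc s a b a<b

  sorted-tabulate : ∀ {k} xs → Sorted xs → length xs ≡ k → ∃ λ (f : Fin k → ℕ) → StrictInc f × tabulate f ≡ xs
  sorted-tabulate xs s ≡.refl = lookup xs , lookup-strictInc s , tabulate-lookup xs

  P-unit : ∀ J → P (unit J)
  P-unit []      = P-1
  P-unit (_ ∷ _) = P-0

  TP⇒NonNegMinors : ∀ {A r} → TP R A r → NonNegMinors A r
  TP⇒NonNegMinors {A} tp []      J sI sJ l = P-unit J
  TP⇒NonNegMinors {A} tp I@(_ ∷ _) J sI sJ l with length J ℕ.≟ length I
  ... | no ne = P-resp (sym (minor-length A I J ne)) P-0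
  ... | yes e with sorted-tabulate I sI ≡.refl | sorted-tabulate J sJ e
  ...   | f , incf , ef | g , incg , eg =
    ≡.subst₂ (λ I J → P (minor A I J)) ef eg
      (P-resp (det-minor _ A f g) (tp _ (s≤s z≤n) l f g incf incg))

  NonNegMinors⇒TP : ∀ {A r} → NonNegMinors A r → TP R A r
  NonNegMinors⇒TP {A} {r} nn k _ l I J incI incJ =
    P-resp (sym (det-minor k A I J))
      (nn (tabulate I) (tabulate J) (AllPairs.tabulate⁺-< (incI _ _)) (AllPairs.tabulate⁺-< (incJ _ _))
          (≡.subst (_≤r r) (≡.sym (length-tabulate I)) l))

≤r-pred : ∀ {n} r → suc n ≤r r → n ≤r r
≤r-pred (fin r) l = ℕ.≤-trans (ℕ.n≤1+n _) l
≤r-pred ∞       l = l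

positive⇒map-suc : ∀ {I} → All (0 <_) I → ∃ λ I′ → I ≡ map suc I′
positive⇒map-suc []                       = [] , ≡.refl
positive⇒map-suc (_∷_ {x = suc i} _ ps) with positive⇒map-suc ps
... | I′ , ≡.refl = i ∷ I′ , ≡.refl

sorted-map-suc : ∀ {I} → Sorted I → Sorted (map suc I)
sorted-map-suc s = AllPairs.map⁺ (AllPairs.map s≤s s)

sorted-map-suc⁻¹ : ∀ {I} → Sorted (map suc I) → Sorted I
sorted-map-suc⁻¹ s = AllPairs.map ℕ.≤-pred (AllPairs.map⁻ s)

sorted-positive : ∀ {i J} → Sorted (i ∷ J) → All (0 <_) J
sorted-positive (p ∷ _) = All.map (ℕ.≤-<-trans z≤n) p

≤-sum : ∀ I → All (_≤ sum I) I
≤-sum []      = []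
≤-sum (i ∷ I) = ℕ.m≤m+n i (sum I) ∷ All.map (λ p → ℕ.≤-trans p (ℕ.m≤n+m (sum I) i)) (≤-sum I)

sorted-upTo : ∀ n → Sorted (upTo n)
sorted-upTo n = AllPairs.applyUpTo⁺₁ id n (λ i<j _ → i<j)

-- Entrywise scaling by factorials

module Scaling {c ℓ} (R : POCRing c ℓ) where
  open POCRing R
  open Sums R
  open Minors R
  open import Algebra.Properties.Ring ring
  open import Algebra.Properties.Semiring.Mult semiring public
    renaming (_×_ to _·_) using (×-congʳ; ×-congˡ; ×-assoc-*; ×-comm-*; ×-assocˡ; ×-homo-+; ×-homo-1)
  open import Algebra.Properties.CommutativeMonoid.Mult +-commutativeMonoid public
    using (×-distrib-+)

  P-· : ∀ n {x} → P x → P (n · x)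
  P-· zero    p = P-0
  P-· (suc n) p = P-+ p (P-· n p)

  ·-* : ∀ m n x y → (m · x) * (n · y) ≈ (m *ℕ n) · (x * y)
  ·-* m n x y = trans (×-assoc-* m x (n · y)) (trans (×-congʳ m (×-comm-* n x y)) (×-assocˡ (x * y) m n))

  ·-neg : ∀ n x → n · (- x) ≈ - (n · x)
  ·-neg zero    x = sym -0#≈0#
  ·-neg (suc n) x = trans (+-congˡ (·-neg n x)) (-‿+-comm x _)

  ·-0 : ∀ n → n · 0# ≈ 0#
  ·-0 zero    = refl
  ·-0 (suc n) = trans (+-identityˡ _) (·-0 n)

  -- x = (p / q) y with an integral quotient p / q, unless x and y both vanish.
  Scaled : ℕ → ℕ → Carrier → Carrier → Set ℓ
  Scaled p q x y = (x ≈ 0# × y ≈ 0#) ⊎ ∃ λ c → c *ℕ q ≡ p × x ≈ c · y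

  Scaled-P : ∀ {p q x y} → Scaled p q x y → P y → P x
  Scaled-P (inj₁ (e , _))     _  = P-resp (sym e) P-0
  Scaled-P (inj₂ (c , _ , e)) py = P-resp (sym e) (P-· c py)

  -- Two integral quotients p / q coincide because `q` is nonzero and can be cancelled, so the
  -- common factor can be taken out; a vanishing pair adopts the quotient of the other.
  Scaled-+ : ∀ {p q x y x′ y′} .{{_ : NonZero q}} → Scaled p q x y → Scaled p q x′ y′ → Scaled p q (x + x′) (y + y′)
  Scaled-+ (inj₁ (e , f)) (inj₁ (e′ , f′)) =
    inj₁ (trans (+-cong e e′) (+-identityˡ 0#) , trans (+-cong f f′) (+-identityˡ 0#))
  Scaled-+ (inj₁ (e , f)) (inj₂ (c , h , e′)) =
    inj₂ (c , h , trans (+-cong e e′) (trans (+-identityˡ _) (×-congʳ c (sym (trans (+-congʳ f) (+-identityˡ _))))))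
  Scaled-+ (inj₂ (c , h , e′)) (inj₁ (e , f)) =
    inj₂ (c , h , trans (+-cong e′ e) (trans (+-identityʳ _) (×-congʳ c (sym (trans (+-congˡ f) (+-identityʳ _))))))
  Scaled-+ {q = q} {y = y} {y′ = y′} (inj₂ (c , h , e)) (inj₂ (c′ , h′ , e′))
    with ℕ.*-cancelʳ-≡ c c′ q (≡.trans h (≡.sym h′))
  ... | ≡.refl = inj₂ (c , h , trans (+-cong e e′) (sym (×-distrib-+ y y′ c)))

  Scaled-neg : ∀ {p q x y} → Scaled p q x y → Scaled p q (- x) (- y)
  Scaled-neg (inj₁ (e , f))     = inj₁ (trans (-‿cong e) -0#≈0# , trans (-‿cong f) -0#≈0#)
  Scaled-neg (inj₂ (c , h , e)) = inj₂ (c , h , trans (-‿cong e) (sym (·-neg c _)))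

  Scaled-* : ∀ {p q x y p′ q′ x′ y′} → Scaled p q x y → Scaled p′ q′ x′ y′ →
             Scaled (p *ℕ p′) (q *ℕ q′) (x * x′) (y * y′)
  Scaled-* (inj₁ (e , f)) _ = inj₁ (trans (*-congʳ e) (zeroˡ _) , trans (*-congʳ f) (zeroˡ _))
  Scaled-* (inj₂ _) (inj₁ (e , f)) = inj₁ (trans (*-congˡ e) (zeroʳ _) , trans (*-congˡ f) (zeroʳ _))
  Scaled-* {q = q} {q′ = q′} (inj₂ (c , h , e)) (inj₂ (c′ , h′ , e′)) =
    inj₂ (c *ℕ c′ , ≡.trans (ℕ.[m*n]*[o*p]≡[m*o]*[n*p] c c′ q q′) (≡.cong₂ _*ℕ_ h h′) ,
          trans (*-cong e e′) (·-* c c′ _ _))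

  factorials : List ℕ → ℕ
  factorials []      = 1
  factorials (j ∷ J) = j ! *ℕ factorials J

  factorials≢0 : ∀ J → NonZero (factorials J)
  factorials≢0 []      = _
  factorials≢0 (j ∷ J) = ℕ.m*n≢0 (j !) (factorials J) {{j ℕ.!≢0}} {{factorials≢0 J}}

  -- Whichever column goes to `f`, the ratio of the terms is the same. The parameter `q` collects
  -- the factorials of columns already contracted: passing from `G` to `∂ c G` replaces `q` by
  -- `q * c!`, which the induction requires.
  ⋀-Scaled : ∀ {p p′ f′ f G′ G} q .{{_ : NonZero q}} →
    (∀ j → Scaled p (j !) (f′ j) (f j)) →
    (∀ J → Scaled p′ (q *ℕ factorials J) (G′ J) (G J)) →
    ∀ J → Scaled (p *ℕ p′) (q *ℕ factorials J) ((f′ ⋀ G′) J) ((f ⋀ G) J)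
  ⋀-Scaled q {{_}} sf sG []      = inj₁ (refl , refl)
  ⋀-Scaled {p} {p′} {f′} {f} {G′} {G} q {{nq}} sf sG (c ∷ J) = Scaled-+ {{nz}} first (Scaled-neg second)
    where
    nz = ℕ.m*n≢0 q (factorials (c ∷ J)) {{nq}} {{factorials≢0 (c ∷ J)}}
    first : Scaled (p *ℕ p′) (q *ℕ factorials (c ∷ J)) (f′ c * G′ J) (f c * G J)
    first = ≡.subst (λ m → Scaled (p *ℕ p′) m (f′ c * G′ J) (f c * G J))
              (x∙yz≈y∙xz (c !) q (factorials J)) (Scaled-* (sf c) (sG J))
      where open import Algebra.Properties.CommutativeSemigroup ℕ.*-commutativeSemigroup using (x∙yz≈y∙xz)
    second : Scaled (p *ℕ p′) (q *ℕ factorials (c ∷ J)) ((f′ ⋀ ∂ c G′) J) ((f ⋀ ∂ c G) J)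
    second = ≡.subst (λ m → Scaled (p *ℕ p′) m ((f′ ⋀ ∂ c G′) J) ((f ⋀ ∂ c G) J))
              (ℕ.*-assoc q (c !) (factorials J))
              (⋀-Scaled (q *ℕ c !) {{ℕ.m*n≢0 q (c !) {{nq}} {{c ℕ.!≢0}}}} sf
                (λ J → ≡.subst (λ m → Scaled p′ m (∂ c G′ J) (∂ c G J)) (≡.sym (ℕ.*-assoc q (c !) (factorials J))) (sG (c ∷ J))) J)

  -- The factor 1 in the denominator is the initial value of `q` in `⋀-Scaled`.
  minor-Scaled : ∀ {A′ A : Matrix} → (∀ i j → Scaled (i !) (j !) (A′ i j) (A i j)) →
    ∀ I J → Scaled (factorials I) (1 *ℕ factorials J) (minor A′ I J) (minor A I J)
  minor-Scaled s []      []      = inj₂ (1 , ≡.refl , sym (×-homo-1 1#))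
  minor-Scaled s []      (_ ∷ _) = inj₁ (refl , refl)
  minor-Scaled s (i ∷ I) J       = ⋀-Scaled 1 (s i) (minor-Scaled s I) J

  Scaled-NonNegMinors : ∀ {A′ A : Matrix} {r} → (∀ i j → Scaled (i !) (j !) (A′ i j) (A i j)) →
    NonNegMinors A r → NonNegMinors A′ r
  Scaled-NonNegMinors s nn I J sI sJ l = Scaled-P (minor-Scaled s I J) (nn I J sI sJ l)

-- Minors of a matrix whose first row is a unit vector

module UnitRow {c ℓ} (R : POCRing c ℓ) where
  open POCRing R
  open Sums R
  open Minors R
  open import Algebra.Properties.Ring ring
  open import Relation.Binary.Reasoning.Setoid setoid

  ⋀-map : ∀ (h : ℕ → ℕ) f G J → (f ⋀ G) (map h J) ≈ ((f ∘ h) ⋀ (G ∘ map h)) J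
  ⋀-map h f G []      = refl
  ⋀-map h f G (j ∷ J) = +-congˡ (-‿cong (⋀-map h f (∂ (h j) G) J))

  minor-map : ∀ (A : Matrix) (g h : ℕ → ℕ) I J → minor A (map g I) (map h J) ≈ minor (λ i j → A (g i) (h j)) I J
  minor-map A g h []      []      = refl
  minor-map A g h []      (_ ∷ _) = refl
  minor-map A g h (i ∷ I) J       = trans (⋀-map h (A (g i)) (minor A (map g I)) J)
                                          (⋀-congˡ (A (g i) ∘ h) (minor-map A g h I) J)

  module _ {E : Matrix} (E₀₀ : E 0 0 ≈ 1#) (E₀ₛ : ∀ j → E 0 (suc j) ≈ 0#) where

    E₀-vanishes : ∀ {J} → All (0 <_) J → All (λ j → E 0 j ≈ 0#) J
    E₀-vanishes = All.map λ where (s≤s {n = j} z≤n) → E₀ₛ j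

    -- A minor that avoids row 0 is covered by `h`. With row 0 but without column 0 it has a zero
    -- row; with both, expansion along row 0 removes them. What remains has rows `map suc I`, which
    -- allows a recurrence for successor rows to be applied.
    P-minor-unit-row : ∀ {N} r →
      (∀ I J → All (_< N) I → Sorted I → Sorted J → length I ≤r r → P (minor E (map suc I) J)) →
      ∀ I J → All (_< suc N) I → Sorted I → Sorted J → length I ≤r r → P (minor E I J)
    P-minor-unit-row r h [] J _ _ _ _ = P-unit J
    P-minor-unit-row {N} r h (suc i ∷ I) J b sI sJ l = positive (s≤s z≤n ∷ sorted-positive sI) b sI sJ l
      where
      positive : ∀ {I J} → All (0 <_) I → All (_< suc N) I → Sorted I → Sorted J → length I ≤r r → P (minor E I J)
      positive ps b sI sJ l with positive⇒map-suc ps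
      ... | I′ , ≡.refl = h I′ _ (All.map ℕ.≤-pred (All.map⁻ b)) (sorted-map-suc⁻¹ sI) sJ
                            (≡.subst (_≤r r) (length-map suc I′) l)
    P-minor-unit-row r h (zero ∷ I) [] b sI sJ l = P-0
    P-minor-unit-row r h (zero ∷ I) (suc j ∷ J) b sI sJ l =
      P-resp (sym (⋀-zero-on (minor E I) (E₀-vanishes (s≤s z≤n ∷ sorted-positive sJ)))) P-0
    P-minor-unit-row r h (zero ∷ I) (zero ∷ J) (_ ∷ b) sI@(_ ∷ sI′) sJ@(_ ∷ sJ′) l
      with positive⇒map-suc (sorted-positive sI)
    ... | I′ , ≡.refl = P-resp (sym step)
      (h I′ J (All.map ℕ.≤-pred (All.map⁻ b)) (sorted-map-suc⁻¹ sI′) sJ′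
         (≡.subst (_≤r r) (length-map suc I′) (≤r-pred r l)))
      where
      step : minor E (0 ∷ map suc I′) (0 ∷ J) ≈ minor E (map suc I′) J
      step = begin
        E 0 0 * minor E (map suc I′) J - (E 0 ⋀ ∂ 0 (minor E (map suc I′))) J
          ≈⟨ +-cong (*-congʳ E₀₀) (-‿cong (⋀-zero-on _ (E₀-vanishes (sorted-positive sJ)))) ⟩
        1# * minor E (map suc I′) J - 0#
          ≈⟨ +-cong (*-identityˡ _) -0#≈0# ⟩
        minor E (map suc I′) J + 0#
          ≈⟨ +-identityʳ _ ⟩
        minor E (map suc I′) J ∎

-- Production matrices

module Production {c ℓ} (R : POCRing c ℓ) where
  open POCRing R
  open Minors R
  open Sums R
  open UnitRow R
  open import Algebra.Properties.Ring ring
  open import Relation.Binary.Reasoning.Setoid setoid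

  module FromRecurrence (r : Rank) (A Ψ : Matrix)
    (A₀₀ : A 0 0 ≈ 1#) (A₀ₛ : ∀ k → A 0 (suc k) ≈ 0#) (Aₛ₀ : ∀ n → A (suc n) 0 ≈ 0#)
    (A-triangular : ∀ {n k} → n < k → A n k ≈ 0#)
    (A-production : ∀ {n N} k → n < N → A (suc n) (suc k) ≈ ∑ (upTo N) (λ i → A n i * Ψ i k))
    (Ψ-TP : NonNegMinors Ψ r) where

    -- The bound `N` is both the induction measure and the cut-off of the product with `Ψ`: all rows
    -- below `N` obey `A-production` with the same range `upTo N`.
    A-TP-bounded : ∀ N I J → All (_< N) I → Sorted I → Sorted J → length I ≤r r → P (minor A I J)
    A-TP-bounded zero    []      J _        _ _ _ = P-unit J
    A-TP-bounded zero    (_ ∷ _) J (() ∷ _) _ _ _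
    A-TP-bounded (suc N) = P-minor-unit-row A₀₀ A₀ₛ r shifted
      where
      shifted : ∀ I J → All (_< N) I → Sorted I → Sorted J → length I ≤r r → P (minor A (map suc I) J)
      -- Every row is a successor, and on those rows column 0 of `A` is zero.
      shifted I (zero ∷ J) b sI sJ l = P-resp (sym (trans (minor-expand-column A (map suc I) 0 J)
        (⋀-zero-on _ (All.map⁺ (All.universal Aₛ₀ I))))) P-0
      shifted I [] b sI sJ l = P-resp (sym (minor-transpose A (map suc I) [])) (P-unit (map suc I))
      shifted I (suc j ∷ J) b sI sJ l with positive⇒map-suc {suc j ∷ J} (s≤s z≤n ∷ sorted-positive sJ)
      ... | J′ , e = P-resp (sym (begin
        minor A (map suc I) (suc j ∷ J)
          ≈⟨ reflexive (≡.cong (minor A (map suc I)) e) ⟩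
        minor A (map suc I) (map suc J′)
          ≈⟨ minor-map A suc suc I J′ ⟩
        minor (λ i j → A (suc i) (suc j)) I J′
          ≈⟨ minor-cong-on (λ {i} {j} i<N (_ : ⊤) → A-production j i<N) b (All.universal (λ _ → _) J′) ⟩
        minor (mul (upTo N) A Ψ) I J′ ∎))
        (P-minor-mul I J′ (sorted-upTo N)
          (λ L sL → A-TP-bounded N I L b sI sL l)
          (λ L sL e → Ψ-TP L J′ sL sJ′ (≡.subst (_≤r r) (≡.sym e) l)))
        where
        sJ′ : Sorted J′
        sJ′ = sorted-map-suc⁻¹ (≡.subst Sorted e sJ)

    A-TP : NonNegMinors A r
    A-TP I J sI sJ l = A-TP-bounded (suc (sum I)) I J (All.map s≤s (≤-sum I)) sI sJ l

    -- Let P be Ψ with a zero column prepended. Row m of V is P^{m+1} e₁, and row m of E is P^m e₁ without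
    -- its entry 0. Products are truncated at M; A-column holds because A is lower triangular.
    module _ (M : ℕ) where

      E : Matrix
      E zero    zero    = 1#
      E zero    (suc _) = 0#
      E (suc m) k       = ∑ (upTo M) (λ j → E m j * Ψ (suc k) j)

      V : Matrix
      V = mul (upTo M) E (Ψ ᵀ)

      V-TP-from : ∀ I J → (∀ L → Sorted L → P (minor E I L)) → Sorted J → length I ≤r r → P (minor V I J)
      V-TP-from I J pE sJ l = P-minor-mul I J (sorted-upTo M) pE
        (λ L sL e → P-resp (minor-transpose Ψ J L) (Ψᵀ-TP L sL e))
        where
        Ψᵀ-TP : ∀ L → Sorted L → length L ≡ length I → P (minor Ψ J L)
        Ψᵀ-TP L sL e with length L ℕ.≟ length J
        ... | yes e′ = Ψ-TP J L sJ sL (≡.subst (_≤r r) (≡.trans (≡.sym e) e′) l)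
        ... | no ne  = P-resp (sym (minor-length Ψ J L ne)) P-0

      -- By definition `E (suc m) k` is `V m (suc k)`. Below its unit row, a minor of `E` is
      -- therefore a minor of `V` with positive columns, and `V-TP-from` reduces it to minors of `E`
      -- whose rows are all one smaller.
      E-TP-bounded : ∀ N I J → All (_< N) I → Sorted I → Sorted J → length I ≤r r → P (minor E I J)
      E-TP-bounded zero    []      J _        _ _ _ = P-unit J
      E-TP-bounded zero    (_ ∷ _) J (() ∷ _) _ _ _
      E-TP-bounded (suc N) = P-minor-unit-row refl (λ _ → refl) r shifted
        where
        shifted : ∀ I J → All (_< N) I → Sorted I → Sorted J → length I ≤r r → P (minor E (map suc I) J)
        shifted I J b sI sJ l = P-resp
          (begin
            minor V I (map suc J)                        ≈⟨ reflexive (≡.cong (λ I → minor V I (map suc J)) (≡.sym (map-id I))) ⟩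
            minor V (map id I) (map suc J)               ≈⟨ minor-map V id suc I J ⟩
            minor (λ i j → E (suc i) j) I J              ≈⟨ minor-map E suc id I J ⟨
            minor E (map suc I) (map id J)               ≈⟨ reflexive (≡.cong (minor E (map suc I)) (map-id J)) ⟩
            minor E (map suc I) J                        ∎)
          (V-TP-from I (map suc J) (λ L sL → E-TP-bounded N I L b sI sL l) (sorted-map-suc sJ) l)

      -- Each row of `A` is the previous one times the production matrix. Associativity moves one
      -- factor of that matrix at a time from the row of `A` to the column vector: `n` drops by one
      -- as `m` grows by one.
      A-column : ∀ m n → n +ℕ m < M → A (suc (n +ℕ m)) 1 ≈ ∑ (upTo M) (λ k → A n k * V m k)
      A-column zero n n<M = begin
        A (suc (n +ℕ 0)) 1                         ≈⟨ reflexive (≡.cong (λ x → A (suc x) 1) (ℕ.+-identityʳ n)) ⟩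
        A (suc n) 1                                ≈⟨ A-production 0 (≡.subst (_< M) (ℕ.+-identityʳ n) n<M) ⟩
        ∑ (upTo M) (λ k → A n k * Ψ k 0)           ≈⟨ ∑-cong (upTo M) (λ k → *-congˡ (sym (first n<M k))) ⟩
        ∑ (upTo M) (λ k → A n k * V 0 k)           ∎
        where
        first : ∀ {n} {M} → n < M → ∀ k → ∑ (upTo M) (λ j → E 0 j * Ψ k j) ≈ Ψ k 0
        first {M = suc M} (s≤s _) k = begin
          ∑ (upTo (suc M)) (λ j → E 0 j * Ψ k j)   ≈⟨ ∑-upTo-suc M (λ j → E 0 j * Ψ k j) ⟩
          1# * Ψ k 0 + ∑ (upTo M) (λ j → 0# * Ψ k (suc j)) ≈⟨ +-cong (*-identityˡ _) (∑-0 (upTo M) (λ _ → zeroˡ _)) ⟩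
          Ψ k 0 + 0#                               ≈⟨ +-identityʳ _ ⟩
          Ψ k 0                                    ∎
      A-column (suc m) n n<M = begin
        A (suc (n +ℕ suc m)) 1
          ≈⟨ reflexive (≡.cong (λ x → A (suc x) 1) (ℕ.+-suc n m)) ⟩
        A (suc (suc n +ℕ m)) 1
          ≈⟨ A-column m (suc n) sn+m<M ⟩
        ∑ (upTo M) (λ k → A (suc n) k * V m k)
          ≈⟨ +-identityʳ _ ⟨
        ∑ (upTo M) (λ k → A (suc n) k * V m k) + 0#
          -- The term at `M` is zero. Once it is added, column 0 can be split off and the shifted
          -- sum again runs over `upTo M`.
          ≈⟨ +-congˡ (trans (*-congʳ (A-triangular (ℕ.≤-<-trans (ℕ.m≤m+n (suc n) m) sn+m<M))) (zeroˡ _)) ⟨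
        ∑ (upTo M) (λ k → A (suc n) k * V m k) + A (suc n) M * V m M
          ≈⟨ ∑-upTo-last M (λ k → A (suc n) k * V m k) ⟨
        ∑ (upTo (suc M)) (λ k → A (suc n) k * V m k)
          ≈⟨ ∑-upTo-suc M (λ k → A (suc n) k * V m k) ⟩
        A (suc n) 0 * V m 0 + ∑ (upTo M) (λ k → A (suc n) (suc k) * V m (suc k))
          ≈⟨ trans (+-congʳ (trans (*-congʳ (Aₛ₀ n)) (zeroˡ _))) (+-identityˡ _) ⟩
        ∑ (upTo M) (λ k → A (suc n) (suc k) * E (suc m) k)
          ≈⟨ ∑-cong (upTo M) (λ k → trans (*-congʳ (A-production k (ℕ.≤-<-trans (ℕ.m≤m+n n (suc m)) n<M))) (sym (∑-*ʳ (upTo M) _ _))) ⟩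
        ∑ (upTo M) (λ k → ∑ (upTo M) (λ i → A n i * Ψ i k * E (suc m) k))
          ≈⟨ ∑-swap (upTo M) (upTo M) (λ k i → A n i * Ψ i k * E (suc m) k) ⟩
        ∑ (upTo M) (λ i → ∑ (upTo M) (λ k → A n i * Ψ i k * E (suc m) k))
          ≈⟨ ∑-cong (upTo M) (λ i → trans
               (∑-cong (upTo M) (λ k → trans (*-assoc _ _ _) (*-congˡ (*-comm _ _))))
               (∑-*ˡ (upTo M) (A n i) _)) ⟩
        ∑ (upTo M) (λ i → A n i * V (suc m) i) ∎
        where
        sn+m<M : suc n +ℕ m < M
        sn+m<M = ≡.subst (_< M) (ℕ.+-suc n m) n<M

    column-HankelTP : NonNegMinors (λ i j → A (suc (i +ℕ j)) 1) r
    column-HankelTP I J sI sJ l = P-resp (sym (minor-cong-on same (≤-sum I) (≤-sum J)))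
      (P-minor-mul I J (sorted-upTo M) (λ L sL → A-TP I L sI sL l)
        (λ L sL e → P-resp (minor-transpose (V M) J L) (V-TP J L sJ sL e)))
      where
      M : ℕ
      -- An entry of a list is at most its sum, so this one cut-off exceeds `i + j` for every entry
      -- of the minor.
      M = suc (sum I +ℕ sum J)
      same : ∀ {i j} → i ≤ sum I → j ≤ sum J → A (suc (i +ℕ j)) 1 ≈ mul (upTo M) A (V M ᵀ) i j
      same {i} {j} p q = A-column M j i (s≤s (ℕ.+-mono-≤ p q))
      V-TP : ∀ J L → Sorted J → Sorted L → length L ≡ length I → P (minor (V M) J L)
      V-TP J L sJ sL e with length L ℕ.≟ length J
      ... | no ne  = P-resp (sym (minor-length (V M) J L ne)) P-0
      ... | yes e′ = V-TP-from M J L (λ K sK → E-TP-bounded M (suc (sum J)) J K (All.map s≤s (≤-sum J)) sJ sK l′) sL l′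
        where
        l′ : length J ≤r r
        l′ = ≡.subst (_≤r r) (≡.trans (≡.sym e) e′) l

-- Levels in increasing forests

Par : ℕ → Set
Par n = Fin n → Maybe (Fin n)

T⇒≡ : ∀ {b} → T b → b ≡ true
T⇒≡ {true} _ = ≡.refl

≡⇒T : ∀ {b} → b ≡ true → T b
≡⇒T ≡.refl = _

bool-ext : ∀ {a b} → (a ≡ true → b ≡ true) → (b ≡ true → a ≡ true) → a ≡ b
bool-ext {true}  {b}     f g = ≡.sym (f ≡.refl)
bool-ext {false} {true}  f g = g ≡.refl
bool-ext {false} {false} f g = ≡.refl

∧-intro : ∀ {a b} → a ≡ true → b ≡ true → a ∧ b ≡ true
∧-intro ≡.refl ≡.refl = ≡.refl

∧-elimˡ : ∀ {a b} → a ∧ b ≡ true → a ≡ true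
∧-elimˡ {true} _ = ≡.refl

∧-elimʳ : ∀ {a b} → a ∧ b ≡ true → b ≡ true
∧-elimʳ {true} e = e

<⇒<ᵇ : ∀ {m n} → m < n → (m <ᵇ n) ≡ true
<⇒<ᵇ p = T⇒≡ (ℕ.<⇒<ᵇ p)

<ᵇ⇒< : ∀ {m n} → (m <ᵇ n) ≡ true → m < n
<ᵇ⇒< {m} {n} e = ℕ.<ᵇ⇒< m n (≡⇒T e)

≤⇒≮ᵇ : ∀ {m n} → n ≤ m → not (m <ᵇ n) ≡ true
≤⇒≮ᵇ {m} {n} p with m <ᵇ n in e
... | false = ≡.refl
... | true  = contradiction (<ᵇ⇒< {m} e) (ℕ.≤⇒≯ p)

≮ᵇ⇒≤ : ∀ {m n} → not (m <ᵇ n) ≡ true → n ≤ m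
≮ᵇ⇒≤ {m} {n} e = ℕ.≮⇒≥ λ p → case ≡.trans (≡.sym e) (≡.cong not (<⇒<ᵇ p)) of λ ()

=ᶠ⇒≡ : ∀ {n} {u v : Fin n} → (u =ᶠ v) ≡ true → u ≡ v
=ᶠ⇒≡ {u = u} {v} e = Fin.toℕ-injective (ℕ.≡ᵇ⇒≡ (toℕ u) (toℕ v) (≡⇒T e))

≡⇒=ᶠ : ∀ {n} {u v : Fin n} → u ≡ v → (u =ᶠ v) ≡ true
≡⇒=ᶠ {u = u} ≡.refl = T⇒≡ (ℕ.≡⇒≡ᵇ (toℕ u) (toℕ u) ≡.refl)

-- Counting over finite index sets

bit : Bool → ℕ
bit b = if b then 1 else 0

length-filterᵇ-∷ : ∀ {a} {A : Set a} (p : A → Bool) x xs →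
                   length (filterᵇ p (x ∷ xs)) ≡ bit (p x) +ℕ length (filterᵇ p xs)
length-filterᵇ-∷ p x xs with p x
... | true  = ≡.refl
... | false = ≡.refl

-- The tail of `allFin (suc n)` is `tabulate fsuc`, not an `allFin`; hence the mutual recursion with
-- `count-suc`.
count-tabulate : ∀ {a} {A : Set a} n (p : A → Bool) (f : Fin n → A) →
                 length (filterᵇ p (tabulate f)) ≡ count (p ∘ f)
count-suc : ∀ {n} (p : Fin (suc n) → Bool) → count p ≡ bit (p fzero) +ℕ count (p ∘ fsuc)

count-suc {n} p = ≡.trans (length-filterᵇ-∷ p fzero (tabulate fsuc))
                        (≡.cong (bit (p fzero) +ℕ_) (count-tabulate n p fsuc))

count-tabulate zero    p f = ≡.refl
count-tabulate (suc n) p f = begin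
  length (filterᵇ p (tabulate f))                              ≡⟨ length-filterᵇ-∷ p (f fzero) _ ⟩
  bit (p (f fzero)) +ℕ length (filterᵇ p (tabulate (f ∘ fsuc))) ≡⟨ ≡.cong (bit (p (f fzero)) +ℕ_) (count-tabulate n p (f ∘ fsuc)) ⟩
  bit (p (f fzero)) +ℕ count (p ∘ f ∘ fsuc)                     ≡⟨ ≡.sym (≡.cong (bit (p (f fzero)) +ℕ_) (count-tabulate n (p ∘ f) fsuc)) ⟩
  bit (p (f fzero)) +ℕ length (filterᵇ (p ∘ f) (tabulate fsuc)) ≡⟨ ≡.sym (length-filterᵇ-∷ (p ∘ f) fzero _) ⟩
  count (p ∘ f)                                                ∎
  where open ≡.≡-Reasoning

count-cong : ∀ {n} {p q : Fin n → Bool} → (∀ v → p v ≡ q v) → count p ≡ count q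
count-cong {zero}          e = ≡.refl
count-cong {suc n} {p} {q} e = ≡.trans (count-suc p)
  (≡.trans (≡.cong₂ _+ℕ_ (≡.cong bit (e fzero)) (count-cong (e ∘ fsuc))) (≡.sym (count-suc q)))

count-+ : ∀ {n} {r p q : Fin n → Bool} → (∀ v → bit (r v) ≡ bit (p v) +ℕ bit (q v)) → count r ≡ count p +ℕ count q
count-+ {zero}              e = ≡.refl
count-+ {suc n} {r} {p} {q} e = begin
  count r                                                                  ≡⟨ count-suc r ⟩
  bit (r fzero) +ℕ count (r ∘ fsuc)                                         ≡⟨ ≡.cong₂ _+ℕ_ (e fzero) (count-+ (e ∘ fsuc)) ⟩
  bit (p fzero) +ℕ bit (q fzero) +ℕ (count (p ∘ fsuc) +ℕ count (q ∘ fsuc))    ≡⟨ interchange (bit (p fzero)) _ _ _ ⟩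
  bit (p fzero) +ℕ count (p ∘ fsuc) +ℕ (bit (q fzero) +ℕ count (q ∘ fsuc))    ≡⟨ ≡.sym (≡.cong₂ _+ℕ_ (count-suc p) (count-suc q)) ⟩
  count p +ℕ count q                                                        ∎
  where
  open ≡.≡-Reasoning
  open import Algebra.Properties.CommutativeSemigroup ℕ.+-commutativeSemigroup using (interchange)

bit≤1 : ∀ b → bit b ≤ 1
bit≤1 true  = s≤s z≤n
bit≤1 false = z≤n

count≤ : ∀ {n} (p : Fin n → Bool) → count p ≤ n
count≤ {zero}  p = z≤n
count≤ {suc n} p = ≡.subst (_≤ suc n) (≡.sym (count-suc p)) (ℕ.+-mono-≤ (bit≤1 (p fzero)) (count≤ (p ∘ fsuc)))

allᶠ-tabulate : ∀ {a} {A : Set a} n (p : A → Bool) (f : Fin n → A) →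
  foldr (λ i b → p i ∧ b) true (tabulate f) ≡ true → ∀ v → p (f v) ≡ true
allᶠ-tabulate (suc n) p f e fzero    = ∧-elimˡ e
allᶠ-tabulate (suc n) p f e (fsuc v) = allᶠ-tabulate n p (f ∘ fsuc) (∧-elimʳ e) v

allᶠ-elim : ∀ {n} {p : Fin n → Bool} → allᶠ p ≡ true → ∀ v → p v ≡ true
allᶠ-elim {n} {p} = allᶠ-tabulate n p id

tabulate-allᶠ : ∀ {a} {A : Set a} n (p : A → Bool) (f : Fin n → A) →
  (∀ v → p (f v) ≡ true) → foldr (λ i b → p i ∧ b) true (tabulate f) ≡ true
tabulate-allᶠ zero    p f e = ≡.refl
tabulate-allᶠ (suc n) p f e = ∧-intro (e fzero) (tabulate-allᶠ n p (f ∘ fsuc) (e ∘ fsuc))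

allᶠ-intro : ∀ {n} {p : Fin n → Bool} → (∀ v → p v ≡ true) → allᶠ p ≡ true
allᶠ-intro {n} {p} = tabulate-allᶠ n p id

anyᶠ-tabulate : ∀ {a} {A : Set a} n (p : A → Bool) (f : Fin n → A) →
  foldr (λ i b → p i ∨ b) false (tabulate f) ≡ true → ∃ λ v → p (f v) ≡ true
anyᶠ-tabulate (suc n) p f e with p (f fzero) in e₀
... | true  = fzero , e₀
... | false with anyᶠ-tabulate n p (f ∘ fsuc) e
...   | v , ev = fsuc v , ev

anyᶠ-elim : ∀ {n} {p : Fin n → Bool} → anyᶠ p ≡ true → ∃ λ v → p v ≡ true
anyᶠ-elim {n} {p} = anyᶠ-tabulate n p id

tabulate-anyᶠ : ∀ {a} {A : Set a} n (p : A → Bool) (f : Fin n → A) v →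
  p (f v) ≡ true → foldr (λ i b → p i ∨ b) false (tabulate f) ≡ true
tabulate-anyᶠ (suc n) p f fzero    e rewrite e = ≡.refl
tabulate-anyᶠ (suc n) p f (fsuc v) e =
  ≡.trans (≡.cong (p (f fzero) ∨_) (tabulate-anyᶠ n p (f ∘ fsuc) v e)) (Bool.∨-zeroʳ _)

anyᶠ-intro : ∀ {n} {p : Fin n → Bool} v → p v ≡ true → anyᶠ p ≡ true
anyᶠ-intro {n} {p} = tabulate-anyᶠ n p id

-- Increasing parent maps

below : ∀ {n} → Fin n → Maybe (Fin n) → Bool
below v nothing  = true
below v (just u) = u <ᶠᵇ v

increasing : ∀ {n} → Par n → Bool
increasing par = allᶠ (λ v → below v (par v))

mutual
  -- The local function `go` of `rootOf`, obtained by unification.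
  climb : ∀ m → Par m → (Fin m → Fin m) → ℕ → Fin m → Fin m
  climb = _

  rootOf-climb : ∀ n (par : Par (suc n)) pos v →
                 rootOf (par , pos) v ≡ maybe (climb (suc n) par pos n) v (par v)
  rootOf-climb n par pos v with par v
  ... | nothing = ≡.refl
  -- Generalising `suc n` to `m` leaves the unknown `climb` applied to distinct variables, and
  -- unification can solve for it.
  ... | just u with suc n
  ...   | m = ≡.refl

climb-suc : ∀ {m} (par : Par m) pos f v → climb m par pos (suc f) v ≡ maybe (climb m par pos f) v (par v)
climb-suc par pos f v with par v
... | nothing = ≡.refl
... | just u  = ≡.refl

climb-≤ : ∀ {m} {par : Par m} pos → increasing par ≡ true → ∀ f v → toℕ (climb m par pos f v) ≤ toℕ v
climb-≤ pos inc zero    v = ℕ.≤-refl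
climb-≤ {par = par} pos inc (suc f) v rewrite climb-suc par pos f v with par v | allᶠ-elim {p = λ v → below v (par v)} inc v
... | nothing | _ = ℕ.≤-refl
... | just u  | e = ℕ.≤-trans (climb-≤ pos inc f u) (ℕ.<⇒≤ (<ᵇ⇒< {toℕ u} e))

rootOf-≤ : ∀ {n} {par : Par n} pos → increasing par ≡ true → ∀ v → toℕ (rootOf (par , pos) v) ≤ toℕ v
rootOf-≤ {suc n} {par} pos inc v =
  ≡.subst (λ w → toℕ w ≤ toℕ v) (≡.trans (climb-suc par pos n v) (≡.sym (rootOf-climb n par pos v))) (climb-≤ {par = par} pos inc (suc n) v)

rootOf-root : ∀ {n} {par : Par n} pos v → isRoot par v ≡ true → rootOf (par , pos) v ≡ v
rootOf-root {suc n} {par} pos v r with par v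
... | nothing = ≡.refl

isRoot-is-nothing : ∀ {n} (par : Par n) v → isRoot par v ≡ is-nothing (par v)
isRoot-is-nothing par v with par v
... | nothing = ≡.refl
... | just _  = ≡.refl

pending : ∀ {n} → Fin n → Maybe (Fin n) → Bool
pending j nothing  = true
pending j (just u) = u <ᶠᵇ j

-- In an increasing forest, the trees with a vertex ≤ j are those with root ≤ j.
lev : ∀ {n} → Par n → Fin n → ℕ
lev par j = suc (count (λ w → (j <ᶠᵇ w) ∧ pending j (par w)))

-- The truncated subtraction is exact: the trees split into the r_j counted by `r` and the `late`
-- ones with root > j, so k+1-r_j is 1 plus the number of late roots. Together with the vertices
-- adopted before j, these are the pending ones.
level≡lev : ∀ {n} (par : Par n) pos → increasing par ≡ true → ∀ j → level (par , pos) j ≡ lev par j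
level≡lev {n} par pos inc j = begin
  count A +ℕ (suc (count (isRoot par)) ∸ count r)  ≡⟨ ≡.cong (λ x → count A +ℕ (suc x ∸ count r)) (count-+ {p = r} {q = late} root-split) ⟩
  count A +ℕ (suc (count r +ℕ count late) ∸ count r) ≡⟨ ≡.cong (λ x → count A +ℕ (x ∸ count r)) (≡.sym (ℕ.+-suc (count r) (count late))) ⟩
  count A +ℕ (count r +ℕ suc (count late) ∸ count r) ≡⟨ ≡.cong (count A +ℕ_) (ℕ.m+n∸m≡n (count r) (suc (count late))) ⟩
  count A +ℕ suc (count late)                       ≡⟨ ℕ.+-suc (count A) (count late) ⟩
  suc (count A +ℕ count late)                       ≡⟨ ≡.cong suc (≡.sym (count-+ {p = A} {q = late} pending-split)) ⟩
  lev par j                                        ∎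
  where
  open ≡.≡-Reasoning
  A r late : Fin n → Bool
  A w    = (j <ᶠᵇ w) ∧ anyᶠ (λ u → (u <ᶠᵇ j) ∧ isParentOf par u w)
  r ρ    = isRoot par ρ ∧ anyᶠ (λ w → not (j <ᶠᵇ w) ∧ (rootOf (par , pos) w =ᶠ ρ))
  late ρ = isRoot par ρ ∧ (j <ᶠᵇ ρ)

  -- A root ρ ≤ j is reached from itself, and climbing from any w ≤ j ends at a label at most j.
  reached : ∀ ρ → isRoot par ρ ≡ true → anyᶠ (λ w → not (j <ᶠᵇ w) ∧ (rootOf (par , pos) w =ᶠ ρ)) ≡ not (j <ᶠᵇ ρ)
  reached ρ root = bool-ext
    (λ e → case anyᶠ-elim e of λ where
      (w , ew) → ≤⇒≮ᵇ (ℕ.≤-trans (≡.subst (λ x → toℕ x ≤ toℕ w) (=ᶠ⇒≡ (∧-elimʳ {not (j <ᶠᵇ w)} ew)) (rootOf-≤ pos inc w))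
                                 (≮ᵇ⇒≤ {toℕ j} (∧-elimˡ ew))))
    (λ e → anyᶠ-intro ρ (∧-intro e (≡⇒=ᶠ (rootOf-root pos ρ root))))

  bit-split : ∀ b → 1 ≡ bit (not b) +ℕ bit b
  bit-split true  = ≡.refl
  bit-split false = ≡.refl

  root-split : ∀ ρ → bit (isRoot par ρ) ≡ bit (r ρ) +ℕ bit (late ρ)
  root-split ρ with isRoot par ρ in root
  ... | false = ≡.refl
  ... | true  = ≡.trans (bit-split (j <ᶠᵇ ρ)) (≡.cong (λ b → bit b +ℕ bit (j <ᶠᵇ ρ)) (≡.sym (reached ρ root)))

  adopted : ∀ w → anyᶠ (λ u → (u <ᶠᵇ j) ∧ isParentOf par u w) ≡ maybe (_<ᶠᵇ j) false (par w)
  adopted w with par w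
  ... | nothing = bool-ext (λ a → case anyᶠ-elim a of λ where (u , e) → ∧-elimʳ {u <ᶠᵇ j} e) (λ ())
  ... | just u  = bool-ext
    (λ a → case anyᶠ-elim a of λ where
      (u′ , e) → ≡.subst (λ x → (x <ᶠᵇ j) ≡ true) (≡.sym (=ᶠ⇒≡ {u = u} (∧-elimʳ {u′ <ᶠᵇ j} e))) (∧-elimˡ e))
    (λ lt → anyᶠ-intro u (∧-intro lt (≡⇒=ᶠ {u = u} ≡.refl)))

  split : ∀ b m → bit (b ∧ pending j m) ≡ bit (b ∧ maybe (_<ᶠᵇ j) false m) +ℕ bit (is-nothing m ∧ b)
  split true  nothing  = ≡.refl
  split false nothing  = ≡.refl
  split b     (just u) = ≡.sym (ℕ.+-identityʳ _)

  pending-split : ∀ w → bit ((j <ᶠᵇ w) ∧ pending j (par w)) ≡ bit (A w) +ℕ bit (late w)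
  pending-split w = ≡.trans (split (j <ᶠᵇ w) (par w))
    (≡.cong₂ (λ a b → bit ((j <ᶠᵇ w) ∧ a) +ℕ bit (b ∧ (j <ᶠᵇ w))) (≡.sym (adopted w)) (≡.sym (isRoot-is-nothing par w)))

hasParent : ∀ {n} → Fin n → Maybe (Fin n) → Bool
hasParent u = maybe (_=ᶠ u) false

isParentOf≡hasParent : ∀ {n} (par : Par n) u w → isParentOf par u w ≡ hasParent u (par w)
isParentOf≡hasParent par u w with par w
... | nothing = ≡.refl
... | just _  = ≡.refl

children : ∀ {m n} → (Fin m → Maybe (Fin n)) → Fin n → ℕ
children c u = count (hasParent u ∘ c)

nChildren≡children : ∀ {n} (par : Par n) pos u → nChildren (par , pos) u ≡ children par u
nChildren≡children par pos u = count-cong (isParentOf≡hasParent par u)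

roots : ∀ {m n} → (Fin m → Maybe (Fin n)) → ℕ
roots c = count (is-nothing ∘ c)

nTrees≡roots : ∀ {n} (par : Par n) pos → nTrees (par , pos) ≡ roots par
nTrees≡roots par pos = count-cong (isRoot-is-nothing par)

-- Orders of siblings

slot : ∀ {n N} → (Fin n → Fin N → Bool) → Maybe (Fin n) → Fin N → Bool
slot A nothing  p = toℕ p ≡ᵇ 0
slot A (just u) p = A u p

remove : ∀ {n N} → (Fin n → Fin N → Bool) → Maybe (Fin n) → Fin N → Fin n → Fin N → Bool
remove A nothing  p = A
remove A (just u) p u′ p′ = A u′ p′ ∧ not ((u =ᶠ u′) ∧ (p =ᶠ p′))

-- q assigns positions one vertex at a time, where A u is the set of positions below u that are still free.
placed : ∀ {m n N} → (Fin m → Maybe (Fin n)) → (Fin n → Fin N → Bool) → (Fin m → Fin N) → Bool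
placed {zero}  c A q = true
placed {suc m} c A q = slot A (c fzero) (q fzero) ∧ placed (c ∘ fsuc) (remove A (c fzero) (q fzero)) (q ∘ fsuc)

DistinctSiblings : ∀ {m n N} → (Fin m → Maybe (Fin n)) → (Fin m → Fin N) → Set
DistinctSiblings c q = ∀ v w u → v ≢ w → c v ≡ just u → c w ≡ just u → q v ≢ q w

slot-remove⁻ : ∀ {n N} (A : Fin n → Fin N → Bool) m p m′ p′ → slot (remove A m p) m′ p′ ≡ true → slot A m′ p′ ≡ true
slot-remove⁻ A m        p nothing  p′ e = e
slot-remove⁻ A nothing  p (just _) p′ e = e
slot-remove⁻ A (just _) p (just _) p′ e = ∧-elimˡ e

slot-removed : ∀ {n N} (A : Fin n → Fin N → Bool) u p p′ → slot (remove A (just u) p) (just u) p′ ≡ true → p ≢ p′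
slot-removed A u p .p e ≡.refl
  with ∧-elimʳ {A u p} e
... | e′ rewrite ≡⇒=ᶠ {u = u} ≡.refl | ≡⇒=ᶠ {u = p} ≡.refl = case e′ of λ ()

slot-remove⁺ : ∀ {n N} (A : Fin n → Fin N → Bool) m p m′ p′ → slot A m′ p′ ≡ true →
               (∀ u → m ≡ just u → m′ ≡ just u → p ≢ p′) → slot (remove A m p) m′ p′ ≡ true
slot-remove⁺ A m        p nothing   p′ e d = e
slot-remove⁺ A nothing  p (just _)  p′ e d = e
slot-remove⁺ A (just u) p (just u′) p′ e d = ∧-intro e distinct
  where
  distinct : not ((u =ᶠ u′) ∧ (p =ᶠ p′)) ≡ true
  distinct with u =ᶠ u′ in eu | p =ᶠ p′ in ep
  ... | false | _     = ≡.refl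
  ... | true  | false = ≡.refl
  ... | true  | true  = contradiction (=ᶠ⇒≡ {u = p} ep) (d u ≡.refl (≡.cong just (≡.sym (=ᶠ⇒≡ {u = u} eu))))

placed-slot : ∀ {m n N} (c : Fin m → Maybe (Fin n)) (A : Fin n → Fin N → Bool) q →
              placed c A q ≡ true → ∀ v → slot A (c v) (q v) ≡ true
placed-slot c A q e fzero    = ∧-elimˡ e
placed-slot c A q e (fsuc v) = slot-remove⁻ A (c fzero) (q fzero) (c (fsuc v)) (q (fsuc v))
  (placed-slot (c ∘ fsuc) _ (q ∘ fsuc) (∧-elimʳ {slot A (c fzero) (q fzero)} e) v)

placed-distinct : ∀ {m n N} (c : Fin m → Maybe (Fin n)) (A : Fin n → Fin N → Bool) q →
                  placed c A q ≡ true → DistinctSiblings c q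
placed-distinct {suc m} c A q e = distinct
  where
  rest = ∧-elimʳ {slot A (c fzero) (q fzero)} e
  first : ∀ w u → c fzero ≡ just u → c (fsuc w) ≡ just u → q fzero ≢ q (fsuc w)
  first w u ev ew with c fzero | c (fsuc w) | placed-slot (c ∘ fsuc) _ (q ∘ fsuc) rest w
  first w u ≡.refl ≡.refl | .(just u) | .(just u) | s = slot-removed A u (q fzero) (q (fsuc w)) s
  distinct : DistinctSiblings c q
  distinct fzero    fzero    u ne ev ew eq = ne ≡.refl
  distinct fzero    (fsuc w) u ne ev ew = first w u ev ew
  distinct (fsuc v) fzero    u ne ev ew = first v u ew ev ∘ ≡.sym
  distinct (fsuc v) (fsuc w) u ne ev ew = placed-distinct (c ∘ fsuc) _ (q ∘ fsuc) rest v w u (ne ∘ ≡.cong fsuc) ev ew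

placed-intro : ∀ {m n N} (c : Fin m → Maybe (Fin n)) (A : Fin n → Fin N → Bool) q →
               (∀ v → slot A (c v) (q v) ≡ true) → DistinctSiblings c q → placed c A q ≡ true
placed-intro {zero}  c A q s d = ≡.refl
placed-intro {suc m} c A q s d = ∧-intro (s fzero) (placed-intro (c ∘ fsuc) _ (q ∘ fsuc)
  (λ v → slot-remove⁺ A (c fzero) (q fzero) (c (fsuc v)) (q (fsuc v)) (s (fsuc v))
           (λ u e e′ → d fzero (fsuc v) u (λ ()) e e′))
  (λ v w u ne → d (fsuc v) (fsuc w) u (ne ∘ Fin.suc-injective)))

free : ∀ {n} → Par n → Fin n → Fin n → Bool
free par u p = toℕ p <ᵇ children par u

mutual
  -- The local functions of `validᵇ`, obtained by unification.
  vertexOK : ∀ {n} → Par n → (Fin n → Fin n) → Fin n → Maybe (Fin n) → Bool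
  vertexOK = _

  valid-vertexOK : ∀ {n} (par : Par n) pos → validᵇ (par , pos) ≡ true → ∀ v → vertexOK par pos v (par v) ≡ true
  valid-vertexOK par pos e v with par v | allᶠ-elim (∧-elimˡ e) v
  ... | m | e′ = e′

  sameParent : ∀ {n} → Par n → (Fin n → Fin n) → Maybe (Fin n) → Maybe (Fin n) → Bool
  sameParent = _

  valid-sameParent : ∀ {n} (par : Par n) pos → validᵇ (par , pos) ≡ true → ∀ v w →
    not (not (v =ᶠ w) ∧ sameParent par pos (par v) (par w)) ∨ not (pos v =ᶠ pos w) ≡ true
  valid-sameParent par pos e v w with par v | par w | allᶠ-elim (allᶠ-elim (∧-elimʳ {allᶠ (λ v → vertexOK par pos v (par v))} e) v) w
  ... | m | m′ | e′ = e′

vertexOK≡ : ∀ {n} (par : Par n) pos v m → vertexOK par pos v m ≡ below v m ∧ slot (free par) m (pos v)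
vertexOK≡ par pos v nothing  = ≡.refl
vertexOK≡ par pos v (just u) = ≡.cong (λ k → (u <ᶠᵇ v) ∧ (toℕ (pos v) <ᵇ k)) (nChildren≡children par pos u)

valid⇒increasing : ∀ {n} (par : Par n) pos → validᵇ (par , pos) ≡ true → increasing par ≡ true
valid⇒increasing par pos e = allᶠ-intro (λ v →
  ∧-elimˡ (≡.trans (≡.sym (vertexOK≡ par pos v (par v))) (valid-vertexOK par pos e v)))

-- Trades the pairwise condition on siblings for a sequential one, whose solutions can be counted
-- vertex by vertex.
valid≡placed : ∀ {n} (par : Par n) pos → increasing par ≡ true → validᵇ (par , pos) ≡ placed par (free par) pos
valid≡placed par pos inc = bool-ext
  (λ e → placed-intro par (free par) pos
    (λ v → ∧-elimʳ {below v (par v)} (≡.trans (≡.sym (vertexOK≡ par pos v (par v))) (valid-vertexOK par pos e v)))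
    (λ v w u ne ev ew eq → distinct v w u ne ev ew eq (valid-sameParent par pos e v w)))
  (λ e → ∧-intro
    (allᶠ-intro (λ v → ≡.trans (vertexOK≡ par pos v (par v)) (∧-intro (allᶠ-elim {p = λ v → below v (par v)} inc v) (placed-slot par (free par) pos e v))))
    (allᶠ-intro (λ v → allᶠ-intro (λ w → apart v w (placed-distinct par (free par) pos e v w)))))
  where
  distinct : ∀ v w u → v ≢ w → par v ≡ just u → par w ≡ just u → pos v ≡ pos w →
    not (not (v =ᶠ w) ∧ sameParent par pos (par v) (par w)) ∨ not (pos v =ᶠ pos w) ≢ true
  distinct v w u ne ev ew eq e rewrite ev | ew | ≡⇒=ᶠ {u = u} ≡.refl | ≡⇒=ᶠ eq with v =ᶠ w in evw
  ... | true  = ne (=ᶠ⇒≡ {u = v} evw)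
  ... | false = case e of λ ()

  apart : ∀ v w → (∀ u → v ≢ w → par v ≡ just u → par w ≡ just u → pos v ≢ pos w) →
    not (not (v =ᶠ w) ∧ sameParent par pos (par v) (par w)) ∨ not (pos v =ᶠ pos w) ≡ true
  apart v w d with v =ᶠ w in evw
  ... | true  = ≡.refl
  ... | false with par v | par w
  ...   | nothing | _       = ≡.refl
  ...   | just u  | nothing = ≡.refl
  ...   | just u  | just u′ with u =ᶠ u′ in eu
  ...     | false = ≡.refl
  ...     | true with pos v =ᶠ pos w in ep
  ...       | false = ≡.refl
  ...       | true  = contradiction (=ᶠ⇒≡ {u = pos v} ep)
    (d u (λ e → case ≡.trans (≡.sym evw) (≡⇒=ᶠ e) of λ ()) ≡.refl (≡.cong just (≡.sym (=ᶠ⇒≡ {u = u} eu))))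

-- Counting the admissible positions

prodᶠ : ∀ {n} → (Fin n → ℕ) → ℕ
prodᶠ {zero}  f = 1
prodᶠ {suc n} f = f fzero *ℕ prodᶠ (f ∘ fsuc)

prodᶠ-cong : ∀ {n} {f g : Fin n → ℕ} → (∀ u → f u ≡ g u) → prodᶠ f ≡ prodᶠ g
prodᶠ-cong {zero}  e = ≡.refl
prodᶠ-cong {suc n} e = ≡.cong₂ _*ℕ_ (e fzero) (prodᶠ-cong (e ∘ fsuc))

prodᶠ-update : ∀ {n} {f g : Fin n → ℕ} u x → f u ≡ x *ℕ g u → (∀ v → v ≢ u → f v ≡ g v) → prodᶠ f ≡ x *ℕ prodᶠ g
prodᶠ-update {suc n} {f} {g} fzero x e d =
  ≡.trans (≡.cong₂ _*ℕ_ e (prodᶠ-cong (λ v → d (fsuc v) λ ()))) (ℕ.*-assoc x (g fzero) _)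
prodᶠ-update {suc n} {f} {g} (fsuc u) x e d =
  ≡.trans (≡.cong₂ _*ℕ_ (d fzero λ ()) (prodᶠ-update u x e (λ v ne → d (fsuc v) (ne ∘ Fin.suc-injective))))
          (x∙yz≈y∙xz (g fzero) x _)
  where open import Algebra.Properties.CommutativeSemigroup ℕ.*-commutativeSemigroup using (x∙yz≈y∙xz)

count-false : ∀ n → count {n} (λ _ → false) ≡ 0
count-false zero    = ≡.refl
count-false (suc n) = ≡.trans (count-suc {n} (λ _ → false)) (count-false n)

count-<ᵇ : ∀ {n k} → k ≤ n → count {n} (λ x → toℕ x <ᵇ k) ≡ k
count-<ᵇ {n} {zero}        _       = count-false n
count-<ᵇ {suc n} {suc k} (s≤s l) = ≡.trans (count-suc {n} (λ x → toℕ x <ᵇ suc k)) (≡.cong suc (count-<ᵇ l))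

count-zero : ∀ n → count {suc n} (λ x → toℕ x ≡ᵇ 0) ≡ 1
count-zero n = ≡.trans (count-suc {n} (λ x → toℕ x ≡ᵇ 0)) (≡.cong suc (count-false n))

count-remove : ∀ {n} (b : Fin n → Bool) p → b p ≡ true → count b ≡ suc (count (λ p′ → b p′ ∧ not (p =ᶠ p′)))
count-remove {suc n} b fzero e = begin
  count b                                        ≡⟨ count-suc b ⟩
  bit (b fzero) +ℕ count (b ∘ fsuc)              ≡⟨ ≡.cong (λ x → bit x +ℕ count (b ∘ fsuc)) e ⟩
  suc (count (b ∘ fsuc))                         ≡⟨ ≡.cong suc (count-cong (λ p → ≡.sym (Bool.∧-identityʳ (b (fsuc p))))) ⟩
  suc (count (λ p → b (fsuc p) ∧ true))          ≡⟨ ≡.cong (λ x → suc (bit x +ℕ count (λ p → b (fsuc p) ∧ true))) (≡.sym (Bool.∧-zeroʳ (b fzero))) ⟩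
  suc (bit (b fzero ∧ false) +ℕ count (λ p → b (fsuc p) ∧ true)) ≡⟨ ≡.cong suc (≡.sym (count-suc (λ p′ → b p′ ∧ not (fzero {n} =ᶠ p′)))) ⟩
  suc (count (λ p′ → b p′ ∧ not (fzero {n} =ᶠ p′))) ∎
  where open ≡.≡-Reasoning
count-remove {suc n} b (fsuc p) e = begin
  count b                                        ≡⟨ count-suc b ⟩
  bit (b fzero) +ℕ count (b ∘ fsuc)              ≡⟨ ≡.cong (bit (b fzero) +ℕ_) (count-remove (b ∘ fsuc) p e) ⟩
  bit (b fzero) +ℕ suc (count (λ p′ → b (fsuc p′) ∧ not (p =ᶠ p′))) ≡⟨ ℕ.+-suc _ _ ⟩
  suc (bit (b fzero) +ℕ count (λ p′ → b (fsuc p′) ∧ not (p =ᶠ p′))) ≡⟨ ≡.cong (λ x → suc (bit x +ℕ count (λ p′ → b (fsuc p′) ∧ not (p =ᶠ p′)))) (≡.sym (Bool.∧-identityʳ (b fzero))) ⟩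
  suc (bit (b fzero ∧ true) +ℕ count (λ p′ → b (fsuc p′) ∧ not (p =ᶠ p′))) ≡⟨ ≡.cong suc (≡.sym (count-suc (λ p′ → b p′ ∧ not (fsuc p =ᶠ p′)))) ⟩
  suc (count (λ p′ → b p′ ∧ not (fsuc p =ᶠ p′))) ∎
  where open ≡.≡-Reasoning

children-suc : ∀ {m n} (c : Fin (suc m) → Maybe (Fin n)) u →
               children c u ≡ bit (hasParent u (c fzero)) +ℕ children (c ∘ fsuc) u
children-suc c u = count-suc (hasParent u ∘ c)

roots-suc : ∀ {m n} (c : Fin (suc m) → Maybe (Fin n)) → roots c ≡ bit (is-nothing (c fzero)) +ℕ roots (c ∘ fsuc)
roots-suc c = count-suc (is-nothing ∘ c)

mutual
  -- The extended lambda in `allFuns`, obtained by unification.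
  consᶠ : ∀ {a} {A : Set a} m (xs : List A) → A → (Fin m → A) → Fin (suc m) → A
  consᶠ = _

  allFuns-suc : ∀ {a} {A : Set a} m (xs : List A) →
    allFuns (suc m) xs ≡ concatMap (λ x → map (consᶠ m xs x) (allFuns m xs)) xs
  allFuns-suc m xs = ≡.refl

-- Preserves the invariant of `∑-placed`: below each vertex there are as many free positions as
-- children still to be placed.
count-removed : ∀ {n N} (A : Fin n → Fin N → Bool) m p u {k} → slot A m p ≡ true →
                count (A u) ≡ bit (hasParent u m) +ℕ k → count (remove A m p u) ≡ k
count-removed A nothing   p u e h = h
count-removed A (just u′) p u e h with u′ =ᶠ u in eu
... | false = ≡.trans (count-cong (λ p′ → Bool.∧-identityʳ (A u p′))) h
... | true with =ᶠ⇒≡ {u = u′} eu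
...   | ≡.refl = ℕ.suc-injective (≡.trans (≡.sym (count-remove (A u) p e)) h)

-- A root has the single choice 0, which exists because positions lie in `Fin (suc N)`. A child of
-- `u` has as many choices as `u` has unplaced children, and only the factor of `u` changes, by k! =
-- k (k-1)!.
count-slot : ∀ {n N} (A : Fin n → Fin (suc N) → Bool) m {k k′ : Fin n → ℕ} →
             (∀ u → k u ≡ bit (hasParent u m) +ℕ k′ u) → (∀ u → count (A u) ≡ k u) →
             prodᶠ (λ u → k u !) ≡ count (slot A m) *ℕ prodᶠ (λ u → k′ u !)
count-slot {N = N} A nothing {k′ = k′} e h = ≡.trans (prodᶠ-cong (λ u → ≡.cong _! (e u)))
  (≡.sym (≡.trans (≡.cong (_*ℕ prodᶠ (λ u → k′ u !)) (count-zero N)) (ℕ.+-identityʳ _)))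
count-slot A (just u) {k} {k′} e h = prodᶠ-update u (count (A u)) here there
  where
  grow : k u ≡ suc (k′ u)
  grow = ≡.trans (e u) (≡.cong (λ b → bit b +ℕ k′ u) (≡⇒=ᶠ {u = u} ≡.refl))
  here : k u ! ≡ count (A u) *ℕ k′ u !
  here = ≡.trans (≡.cong _! grow) (≡.cong (_*ℕ k′ u !) (≡.sym (≡.trans (h u) grow)))
  there : ∀ v → v ≢ u → k v ! ≡ k′ v !
  there v ne with u =ᶠ v in eq | e v
  ... | true  | _  = contradiction (≡.sym (=ᶠ⇒≡ {u = u} eq)) ne
  ... | false | kv = ≡.cong _! kv

-- Deletion of the smallest vertex

-- The first index is the parent of a vertex after the deletion of `fzero`, the second its parent
-- before.
data Lift {n} : Maybe (Fin n) → Maybe (Fin (suc n)) → Set where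
  root  : Lift nothing nothing
  child : Lift nothing (just fzero)
  keep  : ∀ u → Lift (just u) (just (fsuc u))

parents : ∀ n → List (Maybe (Fin n))
parents n = nothing ∷ map just (allFin n)

-- Summing weights over the orders of siblings

module Forests {c ℓ} (R : POCRing c ℓ) where
  open POCRing R
  open Sums R
  open Scaling R
  open import Algebra.Properties.Ring ring
  open import Relation.Binary.Reasoning.Setoid setoid

  [_]_ : Bool → Carrier → Carrier
  [ b ] x = if b then x else 0#
  infix 8 [_]_

  if-cong : ∀ b {x y} → x ≈ y → [ b ] x ≈ [ b ] y
  if-cong true  e = e
  if-cong false e = refl

  if-∧ : ∀ a b x → [ a ∧ b ] x ≈ [ a ] [ b ] x
  if-∧ true  b x = refl
  if-∧ false b x = refl

  ∑-filterᵇ : ∀ {a} {A : Set a} (b : A → Bool) xs f → ∑ (filterᵇ b xs) f ≈ ∑ xs (λ x → [ b x ] f x)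
  ∑-filterᵇ b []       f = refl
  ∑-filterᵇ b (x ∷ xs) f with b x
  ... | true  = +-congˡ (∑-filterᵇ b xs f)
  ... | false = trans (∑-filterᵇ b xs f) (sym (+-identityˡ _))

  ∑-concatMap : ∀ {a b} {A : Set a} {B : Set b} (h : A → List B) xs f → ∑ (concatMap h xs) f ≈ ∑ xs (λ x → ∑ (h x) f)
  ∑-concatMap h []       f = refl
  ∑-concatMap h (x ∷ xs) f = trans (∑-++ (h x) (concatMap h xs) f) (+-congˡ (∑-concatMap h xs f))

  ∑-allFuns : ∀ {a} {A : Set a} m (xs : List A) f →
    ∑ (allFuns (suc m) xs) f ≈ ∑ xs (λ x → ∑ (allFuns m xs) (λ g → f (consᶠ m xs x g)))
  ∑-allFuns m xs f = trans (∑-concatMap (λ x → map (consᶠ m xs x) (allFuns m xs)) xs f)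
                           (∑-cong xs (λ x → ∑-map (consᶠ m xs x) (allFuns m xs) f))

  ∑-tabulate : ∀ {a} {A : Set a} n (g : Fin n → A) f → ∑ (tabulate g) f ≈ ∑ (allFin n) (f ∘ g)
  ∑-tabulate n g f = reflexive (≡.cong (sumR R) (≡.trans (map-tabulate g f) (≡.sym (map-tabulate id (f ∘ g)))))

  ∑-count : ∀ n (b : Fin n → Bool) x → ∑ (allFin n) (λ p → [ b p ] x) ≈ count b · x
  ∑-count zero    b x = refl
  ∑-count (suc n) b x = begin
    [ b fzero ] x + ∑ (tabulate fsuc) (λ p → [ b p ] x) ≈⟨ +-congˡ (trans (∑-tabulate n fsuc _) (∑-count n (b ∘ fsuc) x)) ⟩
    [ b fzero ] x + count (b ∘ fsuc) · x                ≈⟨ +-congʳ (head (b fzero)) ⟩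
    bit (b fzero) · x + count (b ∘ fsuc) · x            ≈⟨ ×-homo-+ x (bit (b fzero)) (count (b ∘ fsuc)) ⟨
    (bit (b fzero) +ℕ count (b ∘ fsuc)) · x             ≈⟨ ×-congˡ (≡.sym (count-suc b)) ⟩
    count b · x                                         ∎
    where
    head : ∀ b → [ b ] x ≈ bit b · x
    head true  = sym (+-identityʳ x)
    head false = refl

  ∏ : ∀ {n} → (Fin n → Carrier) → Carrier
  ∏ {n} f = prodR R (map f (allFin n))

  ∏-suc : ∀ {n} (f : Fin (suc n) → Carrier) → ∏ f ≈ f fzero * ∏ (f ∘ fsuc)
  ∏-suc f = *-congˡ (reflexive (≡.cong (prodR R) (≡.trans (map-tabulate fsuc f) (≡.sym (map-tabulate id (f ∘ fsuc))))))

  ∏-cong : ∀ {n} {f g : Fin n → Carrier} → (∀ v → f v ≈ g v) → ∏ f ≈ ∏ g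
  ∏-cong {zero}          e = refl
  ∏-cong {suc n} {f} {g} e = trans (∏-suc f) (trans (*-cong (e fzero) (∏-cong (e ∘ fsuc))) (sym (∏-suc g)))

  ∏-· : ∀ {n} (a : Fin n → ℕ) (f : Fin n → Carrier) → prodᶠ a · ∏ f ≈ ∏ (λ v → a v · f v)
  ∏-· {zero}  a f = ×-homo-1 1#
  ∏-· {suc n} a f = begin
    (a fzero *ℕ prodᶠ (a ∘ fsuc)) · ∏ f                        ≈⟨ ×-congʳ (a fzero *ℕ prodᶠ (a ∘ fsuc)) (∏-suc f) ⟩
    (a fzero *ℕ prodᶠ (a ∘ fsuc)) · (f fzero * ∏ (f ∘ fsuc))   ≈⟨ ·-* (a fzero) (prodᶠ (a ∘ fsuc)) _ _ ⟨
    (a fzero · f fzero) * (prodᶠ (a ∘ fsuc) · ∏ (f ∘ fsuc))    ≈⟨ *-congˡ (∏-· (a ∘ fsuc) (f ∘ fsuc)) ⟩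
    (a fzero · f fzero) * ∏ (λ v → a (fsuc v) · f (fsuc v))    ≈⟨ ∏-suc (λ v → a v · f v) ⟨
    ∏ (λ v → a v · f v)                                        ∎

  ∑-placed : ∀ {n N} m (c : Fin m → Maybe (Fin n)) (A : Fin n → Fin (suc N) → Bool) x →
    (∀ u → count (A u) ≡ children c u) →
    ∑ (allFuns m (allFin (suc N))) (λ q → [ placed c A q ] x) ≈ prodᶠ (λ u → children c u !) · x
  ∑-placed {n} zero    c A x h = begin
    x + 0#                                   ≈⟨ ×-congˡ (≡.sym (ones n)) ⟩
    prodᶠ (λ u → children c u !) · x         ∎
    where
    ones : ∀ n → prodᶠ {n} (λ _ → 1) ≡ 1
    ones zero    = ≡.refl
    ones (suc n) = ≡.trans (ℕ.+-identityʳ _) (ones n)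
  ∑-placed {n} {N} (suc m) c A x h = begin
    ∑ (allFuns (suc m) (allFin (suc N))) (λ q → [ placed c A q ] x)
      ≈⟨ ∑-allFuns m (allFin (suc N)) _ ⟩
    ∑ (allFin (suc N)) (λ p → ∑ rest (λ q → [ slot A (c fzero) p ∧ placed (c ∘ fsuc) (remove A (c fzero) p) q ] x))
      ≈⟨ ∑-cong (allFin (suc N)) inner ⟩
    ∑ (allFin (suc N)) (λ p → [ slot A (c fzero) p ] (K · x))
      ≈⟨ ∑-count (suc N) (slot A (c fzero)) (K · x) ⟩
    count (slot A (c fzero)) · (K · x)
      ≈⟨ ×-assocˡ x (count (slot A (c fzero))) K ⟩
    (count (slot A (c fzero)) *ℕ K) · x
      ≈⟨ ×-congˡ (≡.sym total) ⟩
    prodᶠ (λ u → children c u !) · x ∎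
    where
    rest = allFuns m (allFin (suc N))
    K = prodᶠ (λ u → children (c ∘ fsuc) u !)

    inner : ∀ p → ∑ rest (λ q → [ slot A (c fzero) p ∧ placed (c ∘ fsuc) (remove A (c fzero) p) q ] x) ≈
                  [ slot A (c fzero) p ] (K · x)
    inner p with slot A (c fzero) p in e
    ... | true  = ∑-placed m (c ∘ fsuc) (remove A (c fzero) p) x (λ u → count-removed A (c fzero) p u e (≡.trans (h u) (children-suc c u)))
    ... | false = ∑-0 rest (λ _ → refl)

    total : prodᶠ (λ u → children c u !) ≡ count (slot A (c fzero)) *ℕ K
    total = count-slot A (c fzero) (children-suc c) h

  module _ (φ : ℕ → ℕ → Carrier) where

    -- The factorial accounts for the orders of the children of `v`, so that only parent maps are
    -- left to sum over.
    vertexTerm : ∀ {n} → Par n → Fin n → Carrier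
    vertexTerm par v = (children par v !) · φ (lev par v) (children par v)

    -- For an increasing parent map, levels and numbers of children do not depend on `pos`. The
    -- weight is thus constant over the valid `pos`, and their number is distributed over the
    -- vertices as factorials.
    ∑-positions : ∀ {n} k (par : Par n) →
      ∑ (allFuns n (allFin n)) (λ pos → [ validᵇ (par , pos) ∧ (nTrees (par , pos) ≡ᵇ k) ] weight R φ (par , pos)) ≈
      [ increasing par ∧ (roots par ≡ᵇ k) ] ∏ (vertexTerm par)
    ∑-positions {n} k par with increasing par in inc
    ... | false = ∑-0 (allFuns n (allFin n)) (λ pos → invalid pos)
      where
      invalid : ∀ pos → [ validᵇ (par , pos) ∧ (nTrees (par , pos) ≡ᵇ k) ] weight R φ (par , pos) ≈ 0#
      invalid pos with validᵇ (par , pos) in e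
      ... | false = refl
      ... | true  = case ≡.trans (≡.sym inc) (valid⇒increasing par pos e) of λ ()
    ... | true = begin
      ∑ (allFuns n (allFin n)) (λ pos → [ validᵇ (par , pos) ∧ (nTrees (par , pos) ≡ᵇ k) ] weight R φ (par , pos))
        ≈⟨ ∑-cong (allFuns n (allFin n)) rewritten ⟩
      ∑ (allFuns n (allFin n)) (λ pos → [ placed par (free par) pos ] [ roots par ≡ᵇ k ] W)
        ≈⟨ counted par ([ roots par ≡ᵇ k ] W) ⟩
      prodᶠ (λ u → children par u !) · [ roots par ≡ᵇ k ] W
        ≈⟨ pull (roots par ≡ᵇ k) ⟩
      [ roots par ≡ᵇ k ] ∏ (vertexTerm par) ∎
      where
      W : Carrier
      W = ∏ (λ v → φ (lev par v) (children par v))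

      rewritten : ∀ pos → [ validᵇ (par , pos) ∧ (nTrees (par , pos) ≡ᵇ k) ] weight R φ (par , pos) ≈
                          [ placed par (free par) pos ] [ roots par ≡ᵇ k ] W
      rewritten pos = begin
        [ validᵇ (par , pos) ∧ (nTrees (par , pos) ≡ᵇ k) ] weight R φ (par , pos)
          ≈⟨ reflexive (≡.cong₂ (λ a b → [ a ∧ (b ≡ᵇ k) ] weight R φ (par , pos)) (valid≡placed par pos inc) (nTrees≡roots par pos)) ⟩
        [ placed par (free par) pos ∧ (roots par ≡ᵇ k) ] weight R φ (par , pos)
          ≈⟨ if-∧ (placed par (free par) pos) (roots par ≡ᵇ k) _ ⟩
        [ placed par (free par) pos ] [ roots par ≡ᵇ k ] weight R φ (par , pos)
          ≈⟨ if-cong (placed par (free par) pos) (if-cong (roots par ≡ᵇ k) (∏-cong (λ v →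
               reflexive (≡.cong₂ φ (level≡lev par pos inc v) (nChildren≡children par pos v))))) ⟩
        [ placed par (free par) pos ] [ roots par ≡ᵇ k ] W ∎

      counted : ∀ {n} (par : Par n) x →
        ∑ (allFuns n (allFin n)) (λ pos → [ placed par (free par) pos ] x) ≈ prodᶠ (λ u → children par u !) · x
      counted {zero}  par x = refl
      counted {suc n} par x = ∑-placed (suc n) par (free par) x
        (λ u → count-<ᵇ (count≤ (hasParent u ∘ par)))

      pull : ∀ b → prodᶠ (λ u → children par u !) · [ b ] W ≈ [ b ] ∏ (vertexTerm par)
      pull true  = ∏-· (λ u → children par u !) (λ v → φ (lev par v) (children par v))
      pull false = ·-0 (prodᶠ (λ u → children par u !))

    Lhat-parents : ∀ n k →
      Lhat R φ n k ≈ ∑ (allFuns n (parents n)) (λ par → [ increasing par ∧ (roots par ≡ᵇ k) ] ∏ (vertexTerm par))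
    Lhat-parents n k = begin
      Lhat R φ n k
        ≈⟨ ∑-filterᵇ (λ F → validᵇ F ∧ (nTrees F ≡ᵇ k)) (allForestCandidates n) (weight R φ) ⟩
      ∑ (allForestCandidates n) (λ F → [ validᵇ F ∧ (nTrees F ≡ᵇ k) ] weight R φ F)
        ≈⟨ ∑-concatMap _ (allFuns n (parents n)) _ ⟩
      ∑ (allFuns n (parents n)) (λ par → ∑ (map (par ,_) (allFuns n (allFin n))) (λ F → [ validᵇ F ∧ (nTrees F ≡ᵇ k) ] weight R φ F))
        ≈⟨ ∑-cong (allFuns n (parents n)) (λ par → trans (∑-map (par ,_) (allFuns n (allFin n)) _) (∑-positions k par)) ⟩
      ∑ (allFuns n (parents n)) (λ par → [ increasing par ∧ (roots par ≡ᵇ k) ] ∏ (vertexTerm par)) ∎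

extensions : ∀ {n} → Maybe (Fin n) → List (Maybe (Fin (suc n)))
extensions nothing  = nothing ∷ just fzero ∷ []
extensions (just u) = just (fsuc u) ∷ []

extensions-Lift : ∀ {n} (x : Maybe (Fin n)) → All (Lift x) (extensions x)
extensions-Lift nothing  = root ∷ child ∷ []
extensions-Lift (just u) = keep u ∷ []

lifts : ∀ {m n} → (Fin m → Maybe (Fin n)) → List (Fin m → Maybe (Fin (suc n)))
lifts {zero}  {n} f = allFuns 0 (parents (suc n))
lifts {suc m} {n} f = concatMap (λ y → map (consᶠ m (parents (suc n)) y) (lifts (f ∘ fsuc))) (extensions (f fzero))

Lifts : ∀ {m n} → (Fin m → Maybe (Fin n)) → (Fin m → Maybe (Fin (suc n))) → Set
Lifts f h = ∀ v → Lift (f v) (h v)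

lifts-Lifts : ∀ {m n} (f : Fin m → Maybe (Fin n)) → All (Lifts f) (lifts f)
lifts-Lifts {zero}  f = (λ ()) ∷ []
lifts-Lifts {suc m} {n} f = All.concat⁺ (All.map⁺ (All.map
  (λ l → All.map⁺ (All.map (λ ls → λ { fzero → l ; (fsuc v) → ls v }) (lifts-Lifts (f ∘ fsuc))))
  (extensions-Lift (f fzero))))

below-Lift : ∀ {n} (v : Fin n) {x y} → Lift x y → below (fsuc v) y ≡ below v x
below-Lift v root     = ≡.refl
below-Lift v child    = ≡.refl
below-Lift v (keep u) = ≡.refl

pending-Lift : ∀ {n} (j : Fin n) {x y} → Lift x y → pending (fsuc j) y ≡ pending j x
pending-Lift j root     = ≡.refl
pending-Lift j child    = ≡.refl
pending-Lift j (keep u) = ≡.refl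

pending-zero-Lift : ∀ {n} {x : Maybe (Fin n)} {y} → Lift x y → pending fzero y ≡ is-nothing y
pending-zero-Lift root     = ≡.refl
pending-zero-Lift child    = ≡.refl
pending-zero-Lift (keep u) = ≡.refl

hasParent-Lift : ∀ {n} (u : Fin n) {x y} → Lift x y → hasParent (fsuc u) y ≡ hasParent u x
hasParent-Lift u root     = ≡.refl
hasParent-Lift u child    = ≡.refl
hasParent-Lift u (keep _) = ≡.refl

root-Lift : ∀ {n} {x : Maybe (Fin n)} {y} → Lift x y → bit (is-nothing x) ≡ bit (hasParent fzero y) +ℕ bit (is-nothing y)
root-Lift root     = ≡.refl
root-Lift child    = ≡.refl
root-Lift (keep u) = ≡.refl

module _ {n} {f : Par n} {h : Fin n → Maybe (Fin (suc n))} (lift : Lifts f h) where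

  grow : Par (suc n)
  grow = consᶠ n (parents (suc n)) nothing h

  increasing-grow : increasing grow ≡ increasing f
  increasing-grow = bool-ext
    (λ e → allᶠ-intro (λ v → ≡.trans (≡.sym (below-Lift v (lift v))) (allᶠ-elim {p = λ v → below v (grow v)} e (fsuc v))))
    (λ e → allᶠ-intro {p = λ v → below v (grow v)} λ where
      fzero    → ≡.refl
      (fsuc v) → ≡.trans (below-Lift v (lift v)) (allᶠ-elim {p = λ v → below v (f v)} e v))

  children-grow-suc : ∀ u → children grow (fsuc u) ≡ children f u
  children-grow-suc u = ≡.trans (children-suc grow (fsuc u)) (count-cong (λ v → hasParent-Lift u (lift v)))

  -- By `root-Lift`, each root of `f` either stays a root in `h` or becomes a child of the new
  -- vertex.
  children-grow-zero : children grow fzero ≡ roots f ∸ roots h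
  children-grow-zero = ≡.sym (≡.trans (≡.cong (_∸ roots h) (count-+ (λ v → root-Lift (lift v))))
    (≡.trans (ℕ.m+n∸n≡m (children h fzero) (roots h)) (≡.sym (children-suc grow fzero))))

  -- No vertex precedes the smallest one, so only the other roots are pending there. This is the
  -- origin of the superscript k+1 in `Ψ`.
  lev-grow-zero : lev grow fzero ≡ suc (roots h)
  lev-grow-zero = ≡.cong suc (≡.trans (count-suc (λ w → (fzero {n} <ᶠᵇ w) ∧ pending fzero (grow w)))
    (count-cong (λ w → pending-zero-Lift (lift w))))

  lev-grow-suc : ∀ j → lev grow (fsuc j) ≡ lev f j
  lev-grow-suc j = ≡.cong suc (≡.trans (count-suc (λ w → (fsuc j <ᶠᵇ w) ∧ pending (fsuc j) (grow w)))
    (count-cong (λ w → ≡.cong ((j <ᶠᵇ w) ∧_) (pending-Lift j (lift w)))))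

nCk*[n∸k]!*k!≡n! : ∀ {n k} → k ≤ n → (n C k) *ℕ (n ∸ k) ! *ℕ k ! ≡ n !
nCk*[n∸k]!*k!≡n! {n} {k} k≤n = begin
  (n C k) *ℕ (n ∸ k) ! *ℕ k !     ≡⟨ ℕ.*-assoc (n C k) _ _ ⟩
  (n C k) *ℕ ((n ∸ k) ! *ℕ k !)   ≡⟨ ≡.cong ((n C k) *ℕ_) (ℕ.*-comm ((n ∸ k) !) (k !)) ⟩
  (n C k) *ℕ (k ! *ℕ (n ∸ k) !)   ≡⟨ ≡.cong (_*ℕ (k ! *ℕ (n ∸ k) !)) (nCk≡n!/k![n-k]! k≤n) ⟩
  _                               ≡⟨ m/n*n≡m {{_}} (k![n∸k]!∣n! k≤n) ⟩
  n !                             ∎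
  where open ≡.≡-Reasoning

-- The recurrence for the forest polynomials

module Recursion {c ℓ} (R : POCRing c ℓ) (φ : ℕ → ℕ → POCRing.Carrier R) where
  open POCRing R
  open Sums R
  open Scaling R
  open Forests R
  open import Relation.Binary.Reasoning.Setoid setoid

  ∑-lifts-suc : ∀ {m n} (f : Fin (suc m) → Maybe (Fin n)) g →
    ∑ (lifts f) g ≈ ∑ (extensions (f fzero)) (λ y → ∑ (lifts (f ∘ fsuc)) (λ h → g (consᶠ m (parents (suc n)) y h)))
  ∑-lifts-suc {m} {n} f g = trans
    (∑-concatMap (λ y → map (consᶠ m (parents (suc n)) y) (lifts (f ∘ fsuc))) (extensions (f fzero)) g)
    (∑-cong (extensions (f fzero)) (λ y → ∑-map (consᶠ m (parents (suc n)) y) (lifts (f ∘ fsuc)) g))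

  ∑-parents : ∀ n g → ∑ (parents (suc n)) g ≈ ∑ (parents n) (λ x → ∑ (extensions x) g)
  ∑-parents n g = begin
    g nothing + (g (just fzero) + ∑ (map just (tabulate fsuc)) g)
      ≈⟨ +-assoc _ _ _ ⟨
    g nothing + g (just fzero) + ∑ (map just (tabulate fsuc)) g
      ≈⟨ +-cong (+-congˡ (sym (+-identityʳ _))) others ⟩
    g nothing + (g (just fzero) + 0#) + ∑ (map just (allFin n)) (λ x → ∑ (extensions x) g) ∎
    where
    others : ∑ (map just (tabulate fsuc)) g ≈ ∑ (map just (allFin n)) (λ x → ∑ (extensions x) g)
    others = begin
      ∑ (map just (tabulate fsuc)) g                ≈⟨ ∑-map just (tabulate fsuc) g ⟩
      ∑ (tabulate fsuc) (g ∘ just)                  ≈⟨ ∑-tabulate n fsuc (g ∘ just) ⟩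
      ∑ (allFin n) (λ u → g (just (fsuc u)))        ≈⟨ ∑-cong (allFin n) (λ u → sym (+-identityʳ _)) ⟩
      ∑ (allFin n) (λ u → ∑ (extensions (just u)) g) ≈⟨ ∑-map just (allFin n) (λ x → ∑ (extensions x) g) ⟨
      ∑ (map just (allFin n)) (λ x → ∑ (extensions x) g) ∎

  -- Every parent map on the left is a lift of exactly one map `f`, in which the children of `fzero`
  -- have become roots; the sum is grouped by that `f`. The domain `m` is kept apart from `n` for
  -- the induction.
  ∑-allFuns-lifts : ∀ m n g → ∑ (allFuns m (parents (suc n))) g ≈ ∑ (allFuns m (parents n)) (λ f → ∑ (lifts f) g)
  ∑-allFuns-lifts zero    n g = sym (+-identityʳ _)
  ∑-allFuns-lifts (suc m) n g = begin
    ∑ (allFuns (suc m) (parents (suc n))) g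
      ≈⟨ ∑-allFuns m (parents (suc n)) g ⟩
    ∑ (parents (suc n)) (λ y → ∑ (allFuns m (parents (suc n))) (g′ y))
      ≈⟨ ∑-parents n _ ⟩
    ∑ (parents n) (λ x → ∑ (extensions x) (λ y → ∑ (allFuns m (parents (suc n))) (g′ y)))
      ≈⟨ ∑-cong (parents n) (λ x → ∑-cong (extensions x) (λ y → ∑-allFuns-lifts m n (g′ y))) ⟩
    ∑ (parents n) (λ x → ∑ (extensions x) (λ y → ∑ (allFuns m (parents n)) (λ f → ∑ (lifts f) (g′ y))))
      ≈⟨ ∑-cong (parents n) (λ x → ∑-swap (extensions x) (allFuns m (parents n)) (λ y f → ∑ (lifts f) (g′ y))) ⟩
    ∑ (parents n) (λ x → ∑ (allFuns m (parents n)) (λ f → ∑ (extensions x) (λ y → ∑ (lifts f) (g′ y))))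
      ≈⟨ ∑-cong (parents n) (λ x → ∑-cong (allFuns m (parents n)) (λ f → ∑-lifts-suc (consᶠ m (parents n) x f) g)) ⟨
    ∑ (parents n) (λ x → ∑ (allFuns m (parents n)) (λ f → ∑ (lifts (consᶠ m (parents n) x f)) g))
      ≈⟨ ∑-allFuns m (parents n) _ ⟨
    ∑ (allFuns (suc m) (parents n)) (λ f → ∑ (lifts f) g) ∎
    where
    g′ : Maybe (Fin (suc n)) → (Fin m → Maybe (Fin (suc n))) → Carrier
    g′ y h = g (consᶠ m (parents (suc n)) y h)

  -- Each root of `f` independently stays a root or moves below the new vertex, which gives Pascal's
  -- rule; the other vertices leave no choice.
  ∑-lifts-roots : ∀ {m n} (f : Fin m → Maybe (Fin n)) k x →
    ∑ (lifts f) (λ h → [ roots h ≡ᵇ k ] x) ≈ (roots f C k) · x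
  ∑-lifts-roots {zero}  f zero    x = refl
  ∑-lifts-roots {zero}  f (suc k) x = trans (+-identityˡ 0#) (×-congˡ {x} {0} {0 C suc k} (≡.sym (k>n⇒nCk≡0 {0} {suc k} (s≤s z≤n))))
  ∑-lifts-roots {suc m} {n} f k x = begin
    ∑ (lifts f) (λ h → [ roots h ≡ᵇ k ] x)
      ≈⟨ ∑-lifts-suc f _ ⟩
    ∑ (extensions (f fzero)) (λ y → ∑ (lifts (f ∘ fsuc)) (λ h → [ roots (consᶠ m (parents (suc n)) y h) ≡ᵇ k ] x))
      ≈⟨ ∑-cong (extensions (f fzero)) (λ y → ∑-cong (lifts (f ∘ fsuc)) (λ h →
           reflexive (≡.cong (λ t → [ t ≡ᵇ k ] x) (roots-suc (consᶠ m (parents (suc n)) y h))))) ⟩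
    ∑ (extensions (f fzero)) (λ y → ∑ (lifts (f ∘ fsuc)) (λ h → [ bit (is-nothing y) +ℕ roots h ≡ᵇ k ] x))
      ≈⟨ pascal (f fzero) k ⟩
    ((bit (is-nothing (f fzero)) +ℕ roots (f ∘ fsuc)) C k) · x
      ≈⟨ ×-congˡ (≡.cong (_C k) (≡.sym (roots-suc f))) ⟩
    (roots f C k) · x ∎
    where
    r = roots (f ∘ fsuc)
    pascal : ∀ y k →
      ∑ (extensions y) (λ y → ∑ (lifts (f ∘ fsuc)) (λ h → [ bit (is-nothing y) +ℕ roots h ≡ᵇ k ] x)) ≈
      ((bit (is-nothing y) +ℕ r) C k) · x
    pascal (just u) k = trans (+-identityʳ _) (∑-lifts-roots (f ∘ fsuc) k x)
    pascal nothing zero = begin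
      ∑ (lifts (f ∘ fsuc)) (λ _ → 0#) + (∑ (lifts (f ∘ fsuc)) (λ h → [ roots h ≡ᵇ 0 ] x) + 0#)
        ≈⟨ +-cong (∑-0 (lifts (f ∘ fsuc)) (λ _ → refl)) (+-identityʳ _) ⟩
      0# + ∑ (lifts (f ∘ fsuc)) (λ h → [ roots h ≡ᵇ 0 ] x)
        ≈⟨ trans (+-identityˡ _) (∑-lifts-roots (f ∘ fsuc) 0 x) ⟩
      (r C 0) · x
        ≈⟨ ×-congˡ (≡.trans (nC0≡1 r) (≡.sym (nC0≡1 (suc r)))) ⟩
      (suc r C 0) · x ∎
      where
      nC0≡1 : ∀ n → n C 0 ≡ 1
      nC0≡1 n = ≡.trans (nCk≡nC[n∸k] {0} {n} z≤n) (nCn≡1 n)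
    pascal nothing (suc k) = begin
      ∑ (lifts (f ∘ fsuc)) (λ h → [ roots h ≡ᵇ k ] x) + (∑ (lifts (f ∘ fsuc)) (λ h → [ roots h ≡ᵇ suc k ] x) + 0#)
        ≈⟨ +-cong (∑-lifts-roots (f ∘ fsuc) k x) (trans (+-identityʳ _) (∑-lifts-roots (f ∘ fsuc) (suc k) x)) ⟩
      (r C k) · x + (r C suc k) · x
        ≈⟨ ×-homo-+ x (r C k) (r C suc k) ⟨
      ((r C k) +ℕ (r C suc k)) · x
        ≈⟨ ×-congˡ (nCk+nC[k+1]≡[n+1]C[k+1] r k) ⟩
      (suc r C suc k) · x ∎

  -- For i < k the truncated `i ∸ k` would leave `φ (suc k) 0`; the binomial coefficient makes the
  -- entry vanish there.
  Ψ : ℕ → ℕ → Carrier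
  Ψ i k = ((i C k) *ℕ (i ∸ k) !) · φ (suc k) (i ∸ k)

  Ψ-Scaled : ∀ i k → Scaled (i !) (k !) (Ψ i k) (Φmat R φ i k)
  Ψ-Scaled i k with k <ᵇ suc i in e
  ... | true  = inj₂ ((i C k) *ℕ (i ∸ k) ! , nCk*[n∸k]!*k!≡n! (ℕ.≤-pred (<ᵇ⇒< {k} e)) , refl)
  ... | false = inj₁ (×-congˡ (≡.cong (_*ℕ (i ∸ k) !) (k>n⇒nCk≡0 {i} {k} (≮ᵇ⇒≤ {k} (≡.cong not e)))) , refl)

  summand : ∀ {n} → ℕ → Par n → Carrier
  summand k par = [ increasing par ∧ (roots par ≡ᵇ k) ] ∏ (vertexTerm φ par)

  summand-grow : ∀ {n} {f : Par n} {h} (lift : Lifts f h) k →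
    summand (suc k) (grow lift) ≈
    [ roots h ≡ᵇ k ] [ increasing f ] ((((roots f ∸ k) !) · φ (suc k) (roots f ∸ k)) * ∏ (vertexTerm φ f))
  summand-grow {n} {f} {h} lift k = begin
    [ increasing (grow lift) ∧ (roots (grow lift) ≡ᵇ suc k) ] ∏ (vertexTerm φ (grow lift))
      ≈⟨ reflexive (≡.cong₂ (λ a b → [ a ∧ (b ≡ᵇ suc k) ] ∏ (vertexTerm φ (grow lift))) (increasing-grow lift) (roots-suc (grow lift))) ⟩
    [ increasing f ∧ (roots h ≡ᵇ k) ] ∏ (vertexTerm φ (grow lift))
      ≈⟨ reflexive (≡.cong ([_] _) (Bool.∧-comm (increasing f) _)) ⟩
    [ (roots h ≡ᵇ k) ∧ increasing f ] ∏ (vertexTerm φ (grow lift))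
      ≈⟨ if-∧ (roots h ≡ᵇ k) (increasing f) _ ⟩
    [ roots h ≡ᵇ k ] [ increasing f ] ∏ (vertexTerm φ (grow lift))
      ≈⟨ weights ⟩
    [ roots h ≡ᵇ k ] [ increasing f ] ((((roots f ∸ k) !) · φ (suc k) (roots f ∸ k)) * ∏ (vertexTerm φ f)) ∎
    where
    product : ∏ (vertexTerm φ (grow lift)) ≈
              (((roots f ∸ roots h) !) · φ (suc (roots h)) (roots f ∸ roots h)) * ∏ (vertexTerm φ f)
    product = trans (∏-suc (vertexTerm φ (grow lift))) (*-cong
      (reflexive (≡.cong₂ (λ c l → (c !) · φ l c) (children-grow-zero lift) (lev-grow-zero lift)))
      (∏-cong (λ v → reflexive (≡.cong₂ (λ c l → (c !) · φ l c) (children-grow-suc lift v) (lev-grow-suc lift v)))))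
    weights : [ roots h ≡ᵇ k ] [ increasing f ] ∏ (vertexTerm φ (grow lift)) ≈
              [ roots h ≡ᵇ k ] [ increasing f ] ((((roots f ∸ k) !) · φ (suc k) (roots f ∸ k)) * ∏ (vertexTerm φ f))
    weights with roots h ≡ᵇ k in e
    ... | false = refl
    -- The indicator forces `roots h` to be `k`, so the factor of the smallest vertex is the same
    -- for all lifts that count.
    ... | true  = if-cong (increasing f) (trans product (reflexive
      (≡.cong (λ k → (((roots f ∸ k) !) · φ (suc k) (roots f ∸ k)) * ∏ (vertexTerm φ f)) (ℕ.≡ᵇ⇒≡ (roots h) k (≡⇒T e)))))

  ∑-upTo-single : ∀ {t N} → t < N → ∀ (f : ℕ → Carrier) → ∑ (upTo N) (λ i → [ t ≡ᵇ i ] f i) ≈ f t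
  ∑-upTo-single {zero}  {suc N} _       f = begin
    ∑ (upTo (suc N)) (λ i → [ 0 ≡ᵇ i ] f i)  ≈⟨ ∑-upTo-suc N _ ⟩
    f 0 + ∑ (upTo N) (λ _ → 0#)              ≈⟨ +-congˡ (∑-0 (upTo N) (λ _ → refl)) ⟩
    f 0 + 0#                                 ≈⟨ +-identityʳ _ ⟩
    f 0                                      ∎
  ∑-upTo-single {suc t} {suc N} (s≤s t<N) f = begin
    ∑ (upTo (suc N)) (λ i → [ suc t ≡ᵇ i ] f i)       ≈⟨ ∑-upTo-suc N _ ⟩
    0# + ∑ (upTo N) (λ i → [ t ≡ᵇ i ] f (suc i))      ≈⟨ +-identityˡ _ ⟩
    ∑ (upTo N) (λ i → [ t ≡ᵇ i ] f (suc i))           ≈⟨ ∑-upTo-single t<N (f ∘ suc) ⟩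
    f (suc t)                                         ∎

  Lhat-suc : ∀ n k → Lhat R φ (suc n) k ≈
    ∑ (allFuns n (parents n)) (λ f → ∑ (lifts f) (λ h → summand k (consᶠ n (parents (suc n)) nothing h)))
  Lhat-suc n k = begin
    Lhat R φ (suc n) k
      ≈⟨ Lhat-parents φ (suc n) k ⟩
    ∑ (allFuns (suc n) (parents (suc n))) (summand k)
      ≈⟨ ∑-allFuns n (parents (suc n)) (summand k) ⟩
    ∑ (allFuns n (parents (suc n))) (λ h → summand k (consᶠ n (parents (suc n)) nothing h)) +
    ∑ (map just (allFin (suc n))) (λ x → ∑ (allFuns n (parents (suc n))) (λ h → summand k (consᶠ n (parents (suc n)) x h)))
      -- No label is below `fzero`, so `increasing` evaluates to `false` as soon as the smallest
      -- vertex has a parent.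
      ≈⟨ +-congˡ (trans (∑-map just (allFin (suc n)) _) (∑-0 (allFin (suc n)) (λ u → ∑-0 (allFuns n (parents (suc n))) (λ h → refl)))) ⟩
    ∑ (allFuns n (parents (suc n))) (λ h → summand k (consᶠ n (parents (suc n)) nothing h)) + 0#
      ≈⟨ +-identityʳ _ ⟩
    ∑ (allFuns n (parents (suc n))) (λ h → summand k (consᶠ n (parents (suc n)) nothing h))
      ≈⟨ ∑-allFuns-lifts n n _ ⟩
    ∑ (allFuns n (parents n)) (λ f → ∑ (lifts f) (λ h → summand k (consᶠ n (parents (suc n)) nothing h))) ∎

  Lhat-production : ∀ {n N} k → n < N → Lhat R φ (suc n) (suc k) ≈ ∑ (upTo N) (λ i → Lhat R φ n i * Ψ i k)
  Lhat-production {n} {N} k n<N = begin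
    Lhat R φ (suc n) (suc k)
      ≈⟨ Lhat-suc n (suc k) ⟩
    ∑ (allFuns n (parents n)) (λ f → ∑ (lifts f) (λ h → summand (suc k) (consᶠ n (parents (suc n)) nothing h)))
      ≈⟨ ∑-cong (allFuns n (parents n)) (λ f → ∑-cong-All (All.map (λ lift → summand-grow lift k) (lifts-Lifts f))) ⟩
    ∑ (allFuns n (parents n)) (λ f → ∑ (lifts f) (λ h → [ roots h ≡ᵇ k ] [ increasing f ] (Z f * ∏ (vertexTerm φ f))))
      ≈⟨ ∑-cong (allFuns n (parents n)) (λ f → ∑-lifts-roots f k _) ⟩
    ∑ (allFuns n (parents n)) (λ f → (roots f C k) · [ increasing f ] (Z f * ∏ (vertexTerm φ f)))
      ≈⟨ ∑-cong (allFuns n (parents n)) (λ f → spread f (increasing f)) ⟩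
    ∑ (allFuns n (parents n)) (λ f → ∑ (upTo N) (λ i → summand i f * Ψ i k))
      ≈⟨ ∑-swap (allFuns n (parents n)) (upTo N) _ ⟩
    ∑ (upTo N) (λ i → ∑ (allFuns n (parents n)) (λ f → summand i f * Ψ i k))
      ≈⟨ ∑-cong (upTo N) (λ i → trans (∑-*ʳ (allFuns n (parents n)) (Ψ i k) (summand i)) (*-congʳ (sym (Lhat-parents φ n i)))) ⟩
    ∑ (upTo N) (λ i → Lhat R φ n i * Ψ i k) ∎
    where
    Z : Par n → Carrier
    Z f = ((roots f ∸ k) !) · φ (suc k) (roots f ∸ k)

    -- The matrix index `i` enters as the number of trees of `f`. As `f` has at most n < N roots,
    -- exactly one `i` in the range matches.
    spread : ∀ f b → (roots f C k) · [ b ] (Z f * ∏ (vertexTerm φ f)) ≈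
                     ∑ (upTo N) (λ i → [ b ∧ (roots f ≡ᵇ i) ] ∏ (vertexTerm φ f) * Ψ i k)
    spread f false = trans (·-0 (roots f C k)) (sym (∑-0 (upTo N) (λ i → zeroˡ _)))
    spread f true  = begin
      (roots f C k) · (Z f * ∏ (vertexTerm φ f))
        ≈⟨ ×-assoc-* (roots f C k) (Z f) (∏ (vertexTerm φ f)) ⟨
      ((roots f C k) · Z f) * ∏ (vertexTerm φ f)
        ≈⟨ *-comm _ _ ⟩
      ∏ (vertexTerm φ f) * ((roots f C k) · Z f)
        ≈⟨ *-congˡ (×-assocˡ _ (roots f C k) ((roots f ∸ k) !)) ⟩
      ∏ (vertexTerm φ f) * Ψ (roots f) k
        ≈⟨ ∑-upTo-single (ℕ.≤-<-trans (count≤ (is-nothing ∘ f)) n<N) (λ i → ∏ (vertexTerm φ f) * Ψ i k) ⟨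
      ∑ (upTo N) (λ i → [ roots f ≡ᵇ i ] (∏ (vertexTerm φ f) * Ψ i k))
        ≈⟨ ∑-cong (upTo N) (λ i → if-*ʳ (roots f ≡ᵇ i) _ _) ⟩
      ∑ (upTo N) (λ i → [ roots f ≡ᵇ i ] ∏ (vertexTerm φ f) * Ψ i k) ∎
      where
      if-*ʳ : ∀ b x y → [ b ] (x * y) ≈ [ b ] x * y
      if-*ʳ true  x y = refl
      if-*ʳ false x y = sym (zeroˡ y)

  Lhat-triangular : ∀ {n k} → n < k → Lhat R φ n k ≈ 0#
  Lhat-triangular {n} {k} n<k = trans (Lhat-parents φ n k) (∑-0 (allFuns n (parents n)) none)
    where
    none : ∀ f → summand k f ≈ 0#
    none f with roots f ≡ᵇ k in e
    ... | true  = contradiction (≡.subst (n <_) (≡.sym (ℕ.≡ᵇ⇒≡ (roots f) k (≡⇒T e))) n<k) (ℕ.≤⇒≯ (count≤ (is-nothing ∘ f)))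
    ... | false with increasing f
    ...   | true  = refl
    ...   | false = refl

  -- The smallest vertex is always a root, so `roots-suc` exhibits the number of trees as a
  -- successor.
  Lhat-suc-zero : ∀ n → Lhat R φ (suc n) 0 ≈ 0#
  Lhat-suc-zero n = trans (Lhat-suc n 0) (∑-0 (allFuns n (parents n)) (λ f → ∑-0 (lifts f) none))
    where
    none : ∀ h → summand 0 (consᶠ n (parents (suc n)) nothing h) ≈ 0#
    none h = reflexive (≡.cong ([_] ∏ (vertexTerm φ par)) (≡.trans
      (≡.cong (λ t → increasing par ∧ (t ≡ᵇ 0)) (roots-suc par)) (Bool.∧-zeroʳ (increasing par))))
      where par = consᶠ n (parents (suc n)) nothing h

theorem3p10 : ∀ {c ℓ} (R : POCRing c ℓ) (r : Rank) (φ : ℕ → ℕ → POCRing.Carrier R) →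
    TP R (Φmat R φ) r →
    TP R (Lhat R φ) r × HankelTP R (λ n → Lhat R φ (suc n) 1) r
theorem3p10 R r φ tp = NonNegMinors⇒TP A-TP , NonNegMinors⇒TP column-HankelTP
  where
  open POCRing R
  open Minors R
  open Scaling R
  open Recursion R φ
  open Production R
  open FromRecurrence r (Lhat R φ) Ψ
    -- For n = 0 the only candidate is the empty forest of weight 1, so `Lhat R φ 0 0` evaluates to
    -- `1# + 0#`.
    (+-identityʳ 1#) (λ _ → refl) Lhat-suc-zero Lhat-triangular Lhat-production
    (Scaled-NonNegMinors Ψ-Scaled (TP⇒NonNegMinors tp))
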